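{- There exists a (randomized) streaming algorithm that, given $n$ coins arriving one by one in a stream in arbitrary order, with gap parameter $\Delta>0$ and confidence parameter $\delta\in(0,1)$, finds the most biased coin with probability at least $1-\delta$ using $O\!\left(\frac{n}{\Delta^2}\cdot\log(1/\delta)\right)$ coin tosses and a memory of $O(\log(n))$ coins.
   Context: Streaming coin tossing. There are $n$ coins with unknown biases $p_1,\dots,p_n\in[0,1]$; each toss of the $i$-th coin is an independent Bernoulli$(p_i)$ random variable. The gap parameter $\Delta$ is the difference between the largest bias and the second largest bias; it is assumed that $\Delta>0$ (so the most biased coin is unique) and that $n,\Delta,\delta$ are known to the algorithm. The coins arrive one by one in a stream. At any time the algorithm may toss only the currently arriving coin or a coin explicitly stored in its memory; a coin that is not stored, or that is removed from memory, can no longer be tossed or recovered. The memory of the algorithm is the maximum number of coins it stores at any point (auxiliary information such as counters is not counted). "Finds the most biased coin" means that at the end of the stream the algorithm outputs the coin with the largest bias. $O(\cdot)$ hides absolute constants. -}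

module Defs where

open import Data.Bool.Base using (Bool; true; false; if_then_else_)
open import Data.Fin.Base using (Fin)
open import Data.Fin.Permutation using (Permutation′; _⟨$⟩ʳ_)
import Data.Fin.Properties as Fin
open import Data.Integer.Base as ℤ using (+_; +[1+_]; -[1+_])
import Data.Integer.Properties as ℤ
open import Data.Integer.Solver using () renaming (module +-*-Solver to ℤ-Solver)
open import Data.Nat.Base as ℕ using (ℕ; zero; suc)
import Data.Nat.Properties as ℕ
open import Data.Product.Base using (∃-syntax; _×_; _,_)
open import Data.Rational.Base
open import Data.Rational.Properties
open import Data.Rational.Solver using (module +-*-Solver)
import Data.Rational.Unnormalised.Base as ℚᵘ
import Data.Rational.Unnormalised.Properties as ℚᵘ
open import Data.Sum.Base using (inj₁; inj₂)
open import Data.Vec.Base using (Vec; []; _∷_; lookup; removeAt; tabulate)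
open import Data.Vec.Functional using (Vector; foldr)
open import Relation.Binary.PropositionalEquality
  using (_≡_; _≢_; refl; sym; trans; cong; subst)
open import Relation.Nullary.Decidable.Core using (does)

open import Algebra.Definitions.RawSemiring +-*-rawSemiring using (_^_)
open +-*-Solver using (solve; _:+_; _:*_; _:-_; :-_; _:=_; con)
open ℤ-Solver using ()
  renaming (solve to ℤ-solve; con to ℤ-con; _:+_ to _:+ℤ_; _:*_ to _:*ℤ_; _:=_ to _:=ℤ_)

ι : ℕ → ℚ
ι n = + n / 1

h : ℕ → ℚ
h k = + 1 / suc k

ι-suc : ∀ n → ι (suc n) ≡ 1ℚ + ι n
ι-suc n = toℚᵘ-injective (begin-equality
  toℚᵘ (ι (suc n))         ≃⟨ toℚᵘ-fromℚᵘ (ℚᵘ.mkℚᵘ (+ suc n) 0) ⟩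
  ℚᵘ.mkℚᵘ (+ suc n) 0      ≃⟨ ℚᵘ.*≡* (ℤ-solve 1 (λ n → (ℤ-con (+ 1) :+ℤ n) :*ℤ ℤ-con (+ 1) :=ℤ (ℤ-con (+ 1) :+ℤ n :*ℤ ℤ-con (+ 1)) :*ℤ ℤ-con (+ 1)) refl (+ n)) ⟩
  ℚᵘ.1ℚᵘ ℚᵘ.+ ℚᵘ.mkℚᵘ (+ n) 0    ≃⟨ ℚᵘ.+-congʳ ℚᵘ.1ℚᵘ (toℚᵘ-fromℚᵘ (ℚᵘ.mkℚᵘ (+ n) 0)) ⟨
  toℚᵘ 1ℚ ℚᵘ.+ toℚᵘ (ι n)  ≃⟨ toℚᵘ-homo-+ 1ℚ (ι n) ⟨
  toℚᵘ (1ℚ + ι n)          ∎)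
  where open ℚᵘ.≤-Reasoning

h*ι : ∀ k → h k * ι (suc k) ≡ 1ℚ
h*ι k = toℚᵘ-injective (begin-equality
  toℚᵘ (h k * ι (suc k))   ≃⟨ toℚᵘ-homo-* (h k) (ι (suc k)) ⟩
  toℚᵘ (h k) ℚᵘ.* toℚᵘ (ι (suc k)) ≃⟨ ℚᵘ.*-cong (toℚᵘ-fromℚᵘ (ℚᵘ.mkℚᵘ (+ 1) k)) (toℚᵘ-fromℚᵘ (ℚᵘ.mkℚᵘ (+ suc k) 0)) ⟩
  ℚᵘ.mkℚᵘ (+ 1) k ℚᵘ.* ℚᵘ.mkℚᵘ (+ suc k) 0 ≃⟨ ℚᵘ.*≡* (cong +_ (trans (ℕ.*-identityʳ _) (sym (trans (ℕ.+-identityʳ _) (cong suc (trans (ℕ.*-identityʳ k) (sym (ℕ.+-identityʳ k)))))))) ⟩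
  ℚᵘ.1ℚᵘ ∎)
  where open ℚᵘ.≤-Reasoning

h-anti : ∀ {m n} → m ℕ.≤ n → h n ≤ h m
h-anti {m} {n} m≤n = toℚᵘ-cancel-≤ (begin
  toℚᵘ (h n)       ≃⟨ toℚᵘ-fromℚᵘ (ℚᵘ.mkℚᵘ (+ 1) n) ⟩
  ℚᵘ.mkℚᵘ (+ 1) n  ≤⟨ ℚᵘ.*≤* (ℤ.+≤+ (ℕ.+-monoˡ-≤ 0 (ℕ.s≤s m≤n))) ⟩
  ℚᵘ.mkℚᵘ (+ 1) m  ≃⟨ toℚᵘ-fromℚᵘ (ℚᵘ.mkℚᵘ (+ 1) m) ⟨
  toℚᵘ (h m)       ∎)
  where open ℚᵘ.≤-Reasoning

0≤h : ∀ k → 0ℚ ≤ h k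
0≤h k = nonNegative⁻¹ (h k) {{normalize-nonNeg 1 (suc k)}}

archimedean : ∀ ε → 0ℚ < ε → ∃[ N ] h N ≤ ε
archimedean ε@(mkℚ +[1+ k ] d c) _ = d , toℚᵘ-cancel-≤ (begin
  toℚᵘ (h d)       ≃⟨ toℚᵘ-fromℚᵘ (ℚᵘ.mkℚᵘ (+ 1) d) ⟩
  ℚᵘ.mkℚᵘ (+ 1) d  ≤⟨ ℚᵘ.*≤* (ℤ.+≤+ (ℕ.*-monoˡ-≤ (suc d) (ℕ.s≤s (ℕ.z≤n {k})))) ⟩
  toℚᵘ ε ∎)
  where open ℚᵘ.≤-Reasoning
archimedean (mkℚ (+ 0) d c) (*<* (ℤ.+<+ ()))
archimedean (mkℚ -[1+ k ] d c) (*<* ())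

by-slack : ∀ {p q} r → 0ℚ ≤ r → p + r ≡ q → p ≤ q
by-slack {p} r 0≤r refl = subst (_≤ p + r) (+-identityʳ p) (+-monoʳ-≤ p 0≤r)

0≤* : ∀ {p q} → 0ℚ ≤ p → 0ℚ ≤ q → 0ℚ ≤ p * q
0≤* {p} {q} 0≤p 0≤q = nonNegative⁻¹ (p * q)
  {{nonNeg*nonNeg⇒nonNeg p {{nonNegative 0≤p}} q {{nonNegative 0≤q}}}}

0≤+ : ∀ {p q} → 0ℚ ≤ p → 0ℚ ≤ q → 0ℚ ≤ p + q
0≤+ = +-mono-≤

0<* : ∀ {p q} → 0ℚ < p → 0ℚ < q → 0ℚ < p * q
0<* {p} {q} 0<p 0<q = positive⁻¹ (p * q)
  {{pos*pos⇒pos p {{positive 0<p}} q {{positive 0<q}}}}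

p≤q⇒0≤q-p : ∀ {p q} → p ≤ q → 0ℚ ≤ q - p
p≤q⇒0≤q-p {p} {q} p≤q = subst (_≤ q - p) (+-inverseʳ p) (+-monoˡ-≤ (- p) p≤q)

*-monoˡ : ∀ {p q} r → 0ℚ ≤ r → p ≤ q → r * p ≤ r * q
*-monoˡ r 0≤r = *-monoˡ-≤-nonNeg r {{nonNegative 0≤r}}

*-monoʳ : ∀ {p q} r → 0ℚ ≤ r → p ≤ q → p * r ≤ q * r
*-monoʳ r 0≤r = *-monoʳ-≤-nonNeg r {{nonNegative 0≤r}}

∣-∣-sym : ∀ p q → ∣ p - q ∣ ≡ ∣ q - p ∣
∣-∣-sym p q = trans (sym (∣-p∣≡∣p∣ (p - q))) (cong ∣_∣ (solve 2 (λ p q → :- (p :- q) := q :- p) refl p q))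

p≤∣p∣ : ∀ p → p ≤ ∣ p ∣
p≤∣p∣ p with ≤-total 0ℚ p
... | inj₁ 0≤p = ≤-reflexive (sym (0≤p⇒∣p∣≡p 0≤p))
... | inj₂ p≤0 = ≤-trans p≤0 (0≤∣p∣ p)

0≤^ : ∀ {a} k → 0ℚ ≤ a → 0ℚ ≤ a ^ k
0≤^ zero    0≤a = *≤* (ℤ.+≤+ ℕ.z≤n)
0≤^ (suc k) 0≤a = 0≤* 0≤a (0≤^ k 0≤a)

^-mono : ∀ {a b} k → 0ℚ ≤ a → a ≤ b → a ^ k ≤ b ^ k
^-mono         zero    0≤a a≤b = ≤-refl
^-mono {a} {b} (suc k) 0≤a a≤b = ≤-trans
  (*-monoˡ a 0≤a (^-mono k 0≤a a≤b))
  (*-monoʳ (b ^ k) (0≤^ k (≤-trans 0≤a a≤b)) a≤b)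

^-anti : ∀ {a} k → 0ℚ ≤ a → a ≤ 1ℚ → a ^ suc k ≤ a ^ k
^-anti {a} k 0≤a a≤1 = subst (a ^ suc k ≤_) (*-identityˡ (a ^ k)) (*-monoʳ (a ^ k) (0≤^ k 0≤a) a≤1)

^≤1 : ∀ {a} k → 0ℚ ≤ a → a ≤ 1ℚ → a ^ k ≤ 1ℚ
^≤1 zero    0≤a a≤1 = ≤-refl
^≤1 (suc k) 0≤a a≤1 = ≤-trans (^-anti k 0≤a a≤1) (^≤1 k 0≤a a≤1)

^-lipschitz : ∀ {a b} k → 0ℚ ≤ a → a ≤ b →
              b ^ suc k - a ^ suc k ≤ ι (suc k) * ((b - a) * b ^ k)
^-lipschitz {a} {b} zero 0≤a a≤b = ≤-reflexive
  (solve 2 (λ a b → b :* con 1ℚ :- a :* con 1ℚ := con 1ℚ :* ((b :- a) :* con 1ℚ)) refl a b)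
^-lipschitz {a} {b} (suc k) 0≤a a≤b = begin
  b * B - a * A
    ≡⟨ solve 4 (λ a b A B → b :* B :- a :* A := b :* (B :- A) :+ (b :- a) :* A) refl a b A B ⟩
  b * (B - A) + (b - a) * A
    ≤⟨ +-mono-≤ (*-monoˡ b (≤-trans 0≤a a≤b) (^-lipschitz k 0≤a a≤b))
                (*-monoˡ (b - a) (p≤q⇒0≤q-p a≤b) (^-mono (suc k) 0≤a a≤b)) ⟩
  b * (ι (suc k) * ((b - a) * b ^ k)) + (b - a) * (b * b ^ k)
    ≡⟨ solve 4 (λ a b n P → b :* (n :* ((b :- a) :* P)) :+ (b :- a) :* (b :* P) := (con 1ℚ :+ n) :* ((b :- a) :* (b :* P))) refl a b (ι (suc k)) (b ^ k) ⟩
  (1ℚ + ι (suc k)) * ((b - a) * (b * b ^ k))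
    ≡⟨ cong (_* ((b - a) * (b * b ^ k))) (ι-suc (suc k)) ⟨
  ι (suc (suc k)) * ((b - a) * (b * b ^ k)) ∎
  where
  open ≤-Reasoning
  A B : ℚ
  A = a ^ suc k
  B = b ^ suc k

-- Partial sums of  - log (1 - a) = Σ_{k ≥ 1} a ^ k / k.
mercator : ℚ → ℕ → ℚ
mercator a zero    = 0ℚ
mercator a (suc k) = mercator a k + a ^ suc k * (+ 1 / suc k)

mercator-mono : ∀ {a} → 0ℚ ≤ a → ∀ m j → mercator a m ≤ mercator a (j ℕ.+ m)
mercator-mono 0≤a m zero    = ≤-refl
mercator-mono 0≤a m (suc j) = ≤-trans (mercator-mono 0≤a m j)
  (by-slack _ (0≤* (0≤^ (suc (j ℕ.+ m)) 0≤a) (0≤h (j ℕ.+ m))) refl)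

module _ {e a : ℚ} (0≤a : 0ℚ ≤ a) (a≤1-e : a ≤ 1ℚ - e) (0≤e : 0ℚ ≤ e) where

  private
    e≤1-a : e ≤ 1ℚ - a
    e≤1-a = by-slack _ (p≤q⇒0≤q-p a≤1-e)
      (solve 2 (λ e a → e :+ ((con 1ℚ :- e) :- a) := con 1ℚ :- a) refl e a)

  below-one : a ≤ 1ℚ
  below-one = ≤-trans a≤1-e (by-slack e 0≤e (solve 1 (λ e → (con 1ℚ :- e) :+ e := con 1ℚ) refl e))

  mercator-tail : ∀ m j →
    e * mercator a (j ℕ.+ m) + h m * a ^ suc (j ℕ.+ m) ≤ e * mercator a m + h m * a ^ suc m
  mercator-tail m zero    = ≤-refl
  mercator-tail m (suc j) = begin
    e * (M + P * h k) + h m * (a * P)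
      ≡⟨ solve 6 (λ e M P hk hm a → e :* (M :+ P :* hk) :+ hm :* (a :* P) := (e :* M :+ hm :* (a :* P)) :+ (e :* P) :* hk) refl e M P (h k) (h m) a ⟩
    (e * M + h m * (a * P)) + (e * P) * h k
      ≤⟨ +-monoʳ-≤ (e * M + h m * (a * P)) (≤-trans (*-monoˡ (e * P) (0≤* 0≤e 0≤P) (h-anti (ℕ.m≤n+m m j)))
              (*-monoʳ (h m) (0≤h m) (*-monoʳ P 0≤P e≤1-a))) ⟩
    (e * M + h m * (a * P)) + ((1ℚ - a) * P) * h m
      ≡⟨ solve 5 (λ e M P hm a → (e :* M :+ hm :* (a :* P)) :+ ((con 1ℚ :- a) :* P) :* hm := e :* M :+ hm :* P) refl e M P (h m) a ⟩
    e * M + h m * P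
      ≤⟨ mercator-tail m j ⟩
    e * mercator a m + h m * a ^ suc m ∎
    where
    open ≤-Reasoning
    k : ℕ
    k = j ℕ.+ m
    M P : ℚ
    M = mercator a k
    P = a ^ suc k
    0≤P : 0ℚ ≤ P
    0≤P = 0≤^ (suc k) 0≤a

  mercator-tail′ : ∀ m j → e * (mercator a (j ℕ.+ m) - mercator a m) ≤ h m
  mercator-tail′ m j = begin
    e * (X - Y)                       ≤⟨ by-slack (h m * a ^ suc (j ℕ.+ m)) (0≤* (0≤h m) (0≤^ (suc (j ℕ.+ m)) 0≤a)) refl ⟩
    e * (X - Y) + h m * a ^ suc (j ℕ.+ m) ≡⟨ solve 4 (λ e X Y t → e :* (X :- Y) :+ t := (e :* X :+ t) :- e :* Y) refl e X Y (h m * a ^ suc (j ℕ.+ m)) ⟩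
    (e * X + h m * a ^ suc (j ℕ.+ m)) - e * Y ≤⟨ +-monoˡ-≤ (- (e * Y)) (mercator-tail m j) ⟩
    (e * Y + h m * a ^ suc m) - e * Y ≡⟨ solve 2 (λ Y t → (Y :+ t) :- Y := t) refl (e * Y) (h m * a ^ suc m) ⟩
    h m * a ^ suc m                   ≤⟨ *-monoˡ (h m) (0≤h m) (^≤1 (suc m) 0≤a below-one) ⟩
    h m * 1ℚ                          ≡⟨ *-identityʳ (h m) ⟩
    h m ∎
    where
    open ≤-Reasoning
    X Y : ℚ
    X = mercator a (j ℕ.+ m)
    Y = mercator a m

mercator-lip : ∀ {e a b} → 0ℚ ≤ a → a ≤ b → b ≤ 1ℚ - e → 0ℚ ≤ e → ∀ m →
  e * mercator b m + (b - a) * b ^ m ≤ e * mercator a m + (b - a)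
mercator-lip {e} {a} {b} 0≤a a≤b b≤ 0≤e zero = ≤-reflexive
  (solve 3 (λ e a b → e :* con 0ℚ :+ (b :- a) :* con 1ℚ := e :* con 0ℚ :+ (b :- a)) refl e a b)
mercator-lip {e} {a} {b} 0≤a a≤b b≤ 0≤e (suc k) = begin
  e * (Mb + B * h k) + (b - a) * (b * P)
    ≡⟨ solve 8 (λ e Mb B A hk a b P → e :* (Mb :+ B :* hk) :+ (b :- a) :* (b :* P) := (e :* Mb :+ (b :- a) :* (b :* P)) :+ (e :* A :* hk :+ (e :* hk) :* (B :- A))) refl e Mb B A (h k) a b P ⟩
  (e * Mb + (b - a) * (b * P)) + (e * A * h k + (e * h k) * (B - A))
    ≤⟨ +-monoʳ-≤ (e * Mb + (b - a) * (b * P)) (+-monoʳ-≤ (e * A * h k) (*-monoˡ (e * h k) (0≤* 0≤e (0≤h k)) (^-lipschitz k 0≤a a≤b))) ⟩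
  (e * Mb + (b - a) * (b * P)) + (e * A * h k + (e * h k) * (ι (suc k) * ((b - a) * P)))
    ≡⟨ cong (λ t → (e * Mb + (b - a) * (b * P)) + (e * A * h k + t)) (trans
         (solve 4 (λ e hk n X → (e :* hk) :* (n :* X) := (hk :* n) :* (e :* X)) refl e (h k) (ι (suc k)) ((b - a) * P))
         (trans (cong (_* (e * ((b - a) * P))) (h*ι k)) (*-identityˡ _))) ⟩
  (e * Mb + (b - a) * (b * P)) + (e * A * h k + e * ((b - a) * P))
    ≤⟨ +-monoʳ-≤ (e * Mb + (b - a) * (b * P)) (+-monoʳ-≤ (e * A * h k) (*-monoʳ ((b - a) * P) (0≤* (p≤q⇒0≤q-p a≤b) (0≤^ k (≤-trans 0≤a a≤b))) e≤1-b)) ⟩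
  (e * Mb + (b - a) * (b * P)) + (e * A * h k + (1ℚ - b) * ((b - a) * P))
    ≡⟨ solve 6 (λ eMb P A' a b e → (eMb :+ (b :- a) :* (b :* P)) :+ (A' :+ (con 1ℚ :- b) :* ((b :- a) :* P)) := (eMb :+ (b :- a) :* P) :+ A') refl (e * Mb) P (e * A * h k) a b e ⟩
  (e * Mb + (b - a) * P) + e * A * h k
    ≤⟨ +-monoˡ-≤ (e * A * h k) (mercator-lip 0≤a a≤b b≤ 0≤e k) ⟩
  (e * Ma + (b - a)) + e * A * h k
    ≡⟨ solve 6 (λ e Ma A hk a b → (e :* Ma :+ (b :- a)) :+ e :* A :* hk := e :* (Ma :+ A :* hk) :+ (b :- a)) refl e Ma A (h k) a b ⟩
  e * (Ma + A * h k) + (b - a) ∎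
  where
  open ≤-Reasoning
  Ma Mb A B P : ℚ
  Ma = mercator a k
  Mb = mercator b k
  A = a ^ suc k
  B = b ^ suc k
  P = b ^ k
  e≤1-b : e ≤ 1ℚ - b
  e≤1-b = by-slack _ (p≤q⇒0≤q-p b≤)
      (solve 2 (λ e a → e :+ ((con 1ℚ :- e) :- a) := con 1ℚ :- a) refl e b)

mercator-monoˡ : ∀ {a b} m → 0ℚ ≤ a → a ≤ b → mercator a m ≤ mercator b m
mercator-monoˡ zero    0≤a a≤b = ≤-refl
mercator-monoˡ (suc k) 0≤a a≤b =
  +-mono-≤ (mercator-monoˡ k 0≤a a≤b) (*-monoʳ (h k) (0≤h k) (^-mono (suc k) 0≤a a≤b))

mercator-lip-≤ : ∀ {e a b} → 0ℚ ≤ a → a ≤ b → b ≤ 1ℚ - e → 0ℚ ≤ e → ∀ m →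
                 e * ∣ mercator b m - mercator a m ∣ ≤ ∣ b - a ∣
mercator-lip-≤ {e} {a} {b} 0≤a a≤b b≤ 0≤e m = begin
  e * ∣ Y - X ∣
    ≡⟨ cong (e *_) (0≤p⇒∣p∣≡p (p≤q⇒0≤q-p (mercator-monoˡ m 0≤a a≤b))) ⟩
  e * (Y - X)
    ≤⟨ by-slack t (0≤* (p≤q⇒0≤q-p a≤b) (0≤^ m (≤-trans 0≤a a≤b))) refl ⟩
  e * (Y - X) + t
    ≡⟨ solve 4 (λ e X Y t → e :* (Y :- X) :+ t := (e :* Y :+ t) :- e :* X) refl e X Y t ⟩
  (e * Y + t) - e * X
    ≤⟨ +-monoˡ-≤ (- (e * X)) (mercator-lip 0≤a a≤b b≤ 0≤e m) ⟩
  (e * X + (b - a)) - e * X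
    ≡⟨ solve 2 (λ X t → (X :+ t) :- X := t) refl (e * X) (b - a) ⟩
  b - a
    ≤⟨ p≤∣p∣ (b - a) ⟩
  ∣ b - a ∣ ∎
  where
  open ≤-Reasoning
  X Y t : ℚ
  X = mercator a m
  Y = mercator b m
  t = (b - a) * b ^ m

mercator-lipschitz : ∀ {e a b} → 0ℚ ≤ a → a ≤ 1ℚ - e → 0ℚ ≤ b → b ≤ 1ℚ - e → 0ℚ ≤ e → ∀ m →
                     e * ∣ mercator a m - mercator b m ∣ ≤ ∣ a - b ∣
mercator-lipschitz {e} {a} {b} 0≤a a≤ 0≤b b≤ 0≤e m with ≤-total a b
... | inj₁ a≤b = begin
  e * ∣ mercator a m - mercator b m ∣ ≡⟨ cong (e *_) (∣-∣-sym (mercator a m) (mercator b m)) ⟩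
  e * ∣ mercator b m - mercator a m ∣ ≤⟨ mercator-lip-≤ 0≤a a≤b b≤ 0≤e m ⟩
  ∣ b - a ∣                           ≡⟨ ∣-∣-sym b a ⟩
  ∣ a - b ∣                           ∎
  where open ≤-Reasoning
... | inj₂ b≤a = mercator-lip-≤ 0≤b b≤a a≤ 0≤e m

mercator-close : ∀ {e a b η} → 0ℚ ≤ a → a ≤ 1ℚ - e → 0ℚ ≤ b → b ≤ 1ℚ - e → 0ℚ ≤ e →
                 ∣ a - b ∣ ≤ η → ∀ {m n} → h m ≤ η → m ℕ.≤ n →
                 e * ∣ mercator a m - mercator b n ∣ ≤ η + η
mercator-close {e} {a} {b} {η} 0≤a a≤ 0≤b b≤ 0≤e ab {m} {n} hm m≤n =
  subst (λ n → e * ∣ mercator a m - mercator b n ∣ ≤ η + η) (ℕ.m∸n+n≡m m≤n) (begin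
    e * ∣ X - Z ∣
      ≡⟨ cong (λ t → e * ∣ t ∣) (solve 3 (λ X Y Z → X :- Z := (X :- Y) :+ (Y :- Z)) refl X Y Z) ⟩
    e * ∣ (X - Y) + (Y - Z) ∣
      ≤⟨ *-monoˡ e 0≤e (∣p+q∣≤∣p∣+∣q∣ (X - Y) (Y - Z)) ⟩
    e * (∣ X - Y ∣ + ∣ Y - Z ∣)
      ≡⟨ *-distribˡ-+ e ∣ X - Y ∣ ∣ Y - Z ∣ ⟩
    e * ∣ X - Y ∣ + e * ∣ Y - Z ∣
      ≡⟨ cong (λ t → e * ∣ X - Y ∣ + e * t)
           (trans (∣-∣-sym Y Z) (0≤p⇒∣p∣≡p (p≤q⇒0≤q-p (mercator-mono 0≤b m (n ℕ.∸ m))))) ⟩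
    e * ∣ X - Y ∣ + e * (Z - Y)
      ≤⟨ +-mono-≤ (≤-trans (mercator-lipschitz 0≤a a≤ 0≤b b≤ 0≤e m) ab)
                  (≤-trans (mercator-tail′ 0≤b b≤ 0≤e m (n ℕ.∸ m)) hm) ⟩
    η + η ∎)
  where
  open ≤-Reasoning
  X Y Z : ℚ
  X = mercator a m
  Y = mercator b m
  Z = mercator b (n ℕ.∸ m ℕ.+ m)

half : ∀ ε → ½ * ε + ½ * ε ≡ ε
half = solve 1 (λ ε → con ½ :* ε :+ con ½ :* ε := ε) refl

0<½ : 0ℚ < ½
0<½ = *<* (ℤ.+<+ (ℕ.s≤s ℕ.z≤n))

scale-down : ∀ B ε → 0ℚ ≤ B → 0ℚ < ε → ∃[ η ] (0ℚ < η × B * η ≤ ε)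
scale-down B ε 0≤B 0<ε = ε * c⁻¹ , 0<* 0<ε 0<c⁻¹ , (begin
  B * (ε * c⁻¹)       ≤⟨ by-slack (ε * c⁻¹) (<⇒≤ (0<* 0<ε 0<c⁻¹)) refl ⟩
  B * (ε * c⁻¹) + ε * c⁻¹
                      ≡⟨ solve 3 (λ B ε d → B :* (ε :* d) :+ ε :* d := ((con 1ℚ :+ B) :* d) :* ε) refl B ε c⁻¹ ⟩
  (c * c⁻¹) * ε       ≡⟨ cong (_* ε) (*-inverseʳ c) ⟩
  1ℚ * ε              ≡⟨ *-identityˡ ε ⟩
  ε                   ∎)
  where
  open ≤-Reasoning
  c : ℚ
  c = 1ℚ + B
  instance
    c-pos : Positive c
    c-pos = pos+nonNeg⇒pos 1ℚ B {{nonNegative 0≤B}}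
    c-nonZero : NonZero c
    c-nonZero = pos⇒nonZero c
  c⁻¹ : ℚ
  c⁻¹ = 1/ c
  0<c⁻¹ : 0ℚ < c⁻¹
  0<c⁻¹ = positive⁻¹ c⁻¹ {{1/pos⇒pos c}}

record ℝ : Set where
  constructor mkℝ
  field
    seq    : ℕ → ℚ
    cauchy : ∀ ε → 0ℚ < ε →
             ∃[ N ] (∀ m n → N ℕ.≤ m → N ℕ.≤ n → ∣ seq m - seq n ∣ ≤ ε)

open ℝ public

infix 4 _≤ᴿ_ _<ᴿ_ _≈ᴿ_

_≤ᴿ_ : ℝ → ℝ → Set
x ≤ᴿ y = ∀ ε → 0ℚ < ε → ∃[ N ] (∀ n → N ℕ.≤ n → seq x n ≤ seq y n + ε)

_<ᴿ_ : ℝ → ℝ → Set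
x <ᴿ y = ∃[ ε ] (0ℚ < ε × ∃[ N ] (∀ n → N ℕ.≤ n → seq x n + ε ≤ seq y n))

_≈ᴿ_ : ℝ → ℝ → Set
x ≈ᴿ y = x ≤ᴿ y × y ≤ᴿ x

fromℚ : ℚ → ℝ
fromℚ q = mkℝ (λ _ → q) λ ε 0<ε → 0 , λ _ _ _ _ →
  subst (λ t → ∣ t ∣ ≤ ε) (sym (+-inverseʳ q)) (<⇒≤ 0<ε)

fromℕ : ℕ → ℝ
fromℕ n = fromℚ (+ n / 1)

0ᴿ 1ᴿ : ℝ
0ᴿ = fromℚ 0ℚ
1ᴿ = fromℚ 1ℚ

infixl 6 _+ᴿ_ _-ᴿ_
infixl 7 _*ᴿ_
infix  8 -ᴿ_

_+ᴿ_ : ℝ → ℝ → ℝ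
x +ᴿ y = mkℝ (λ n → seq x n + seq y n) λ ε 0<ε →
  let M , p = cauchy x (½ * ε) (0<* 0<½ 0<ε)
      N , q = cauchy y (½ * ε) (0<* 0<½ 0<ε)
  in M ℕ.⊔ N , λ m n m≥ n≥ → begin
    ∣ (seq x m + seq y m) - (seq x n + seq y n) ∣
      ≡⟨ cong ∣_∣ (solve 4 (λ a b c d → (a :+ b) :- (c :+ d) := (a :- c) :+ (b :- d)) refl
           (seq x m) (seq y m) (seq x n) (seq y n)) ⟩
    ∣ (seq x m - seq x n) + (seq y m - seq y n) ∣
      ≤⟨ ∣p+q∣≤∣p∣+∣q∣ (seq x m - seq x n) (seq y m - seq y n) ⟩
    ∣ seq x m - seq x n ∣ + ∣ seq y m - seq y n ∣
      ≤⟨ +-mono-≤ (p m n (ℕ.m⊔n≤o⇒m≤o M N m≥) (ℕ.m⊔n≤o⇒m≤o M N n≥))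
                  (q m n (ℕ.m⊔n≤o⇒n≤o M N m≥) (ℕ.m⊔n≤o⇒n≤o M N n≥)) ⟩
    ½ * ε + ½ * ε
      ≡⟨ half ε ⟩
    ε ∎
  where open ≤-Reasoning

-ᴿ_ : ℝ → ℝ
-ᴿ x = mkℝ (λ n → - seq x n) λ ε 0<ε →
  let N , p = cauchy x ε 0<ε
  in N , λ m n m≥ n≥ → subst (_≤ ε)
       (trans (∣-∣-sym (seq x m) (seq x n))
         (cong ∣_∣ (solve 2 (λ a b → b :- a := (:- a) :- (:- b)) refl (seq x m) (seq x n))))
       (p m n m≥ n≥)

_-ᴿ_ : ℝ → ℝ → ℝ
x -ᴿ y = x +ᴿ (-ᴿ y)

eventually-bounded : ∀ x → ∃[ B ] (0ℚ ≤ B × ∃[ N ] (∀ n → N ℕ.≤ n → ∣ seq x n ∣ ≤ B))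
eventually-bounded x =
  let N , p = cauchy x 1ℚ (*<* (ℤ.+<+ (ℕ.s≤s ℕ.z≤n)))
  in 1ℚ + ∣ seq x N ∣
   , 0≤+ {1ℚ} (*≤* (ℤ.+≤+ ℕ.z≤n)) (0≤∣p∣ (seq x N))
   , N
   , λ n n≥ → begin
       ∣ seq x n ∣
         ≡⟨ cong ∣_∣ (solve 2 (λ a b → a := (a :- b) :+ b) refl (seq x n) (seq x N)) ⟩
       ∣ (seq x n - seq x N) + seq x N ∣
         ≤⟨ ∣p+q∣≤∣p∣+∣q∣ (seq x n - seq x N) (seq x N) ⟩
       ∣ seq x n - seq x N ∣ + ∣ seq x N ∣
         ≤⟨ +-monoˡ-≤ ∣ seq x N ∣ (p n N n≥ ℕ.≤-refl) ⟩
       1ℚ + ∣ seq x N ∣ ∎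
  where open ≤-Reasoning

_*ᴿ_ : ℝ → ℝ → ℝ
x *ᴿ y = mkℝ (λ n → seq x n * seq y n) λ ε 0<ε →
  let A , 0≤A , K , bx = eventually-bounded x
      B , 0≤B , L , by = eventually-bounded y
      η , 0<η , Aη≤    = scale-down A (½ * ε) 0≤A (0<* 0<½ 0<ε)
      θ , 0<θ , Bθ≤    = scale-down B (½ * ε) 0≤B (0<* 0<½ 0<ε)
      M , p            = cauchy y η 0<η
      N , q            = cauchy x θ 0<θ
      KL≤ : ∀ {n} → (K ℕ.⊔ L) ℕ.⊔ (M ℕ.⊔ N) ℕ.≤ n → K ℕ.⊔ L ℕ.≤ n
      KL≤ = ℕ.m⊔n≤o⇒m≤o (K ℕ.⊔ L) (M ℕ.⊔ N)
      MN≤ : ∀ {n} → (K ℕ.⊔ L) ℕ.⊔ (M ℕ.⊔ N) ℕ.≤ n → M ℕ.⊔ N ℕ.≤ n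
      MN≤ = ℕ.m⊔n≤o⇒n≤o (K ℕ.⊔ L) (M ℕ.⊔ N)
  in (K ℕ.⊔ L) ℕ.⊔ (M ℕ.⊔ N) , λ m n m≥ n≥ → begin
    ∣ seq x m * seq y m - seq x n * seq y n ∣
      ≡⟨ cong ∣_∣ (solve 4 (λ a b c d → a :* b :- c :* d := a :* (b :- d) :+ d :* (a :- c)) refl
           (seq x m) (seq y m) (seq x n) (seq y n)) ⟩
    ∣ seq x m * (seq y m - seq y n) + seq y n * (seq x m - seq x n) ∣
      ≤⟨ ∣p+q∣≤∣p∣+∣q∣ (seq x m * (seq y m - seq y n)) (seq y n * (seq x m - seq x n)) ⟩
    ∣ seq x m * (seq y m - seq y n) ∣ + ∣ seq y n * (seq x m - seq x n) ∣
      ≤⟨ +-mono-≤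
           (∣*∣≤ (seq x m) (bx m (ℕ.m⊔n≤o⇒m≤o K L (KL≤ m≥))) 0≤A
             (p m n (ℕ.m⊔n≤o⇒m≤o M N (MN≤ m≥)) (ℕ.m⊔n≤o⇒m≤o M N (MN≤ n≥))))
           (∣*∣≤ (seq y n) (by n (ℕ.m⊔n≤o⇒n≤o K L (KL≤ n≥))) 0≤B
             (q m n (ℕ.m⊔n≤o⇒n≤o M N (MN≤ m≥)) (ℕ.m⊔n≤o⇒n≤o M N (MN≤ n≥)))) ⟩
    A * η + B * θ
      ≤⟨ +-mono-≤ Aη≤ Bθ≤ ⟩
    ½ * ε + ½ * ε
      ≡⟨ half ε ⟩
    ε ∎
  where
  open ≤-Reasoning
  ∣*∣≤ : ∀ p {q C γ} → ∣ p ∣ ≤ C → 0ℚ ≤ C → ∣ q ∣ ≤ γ → ∣ p * q ∣ ≤ C * γ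
  ∣*∣≤ p {q} {C} p≤ 0≤C q≤ = ≤-trans (≤-reflexive (∣p*q∣≡∣p∣*∣q∣ p q))
    (≤-trans (*-monoʳ ∣ q ∣ (0≤∣p∣ q) p≤) (*-monoˡ C 0≤C q≤))

Σᴿ : ∀ {k} → Vector ℝ k → ℝ
Σᴿ = foldr _+ᴿ_ 0ᴿ

-- The natural logarithm of 1 / x for 0 < x < 1, by the Mercator series
--   log (1 / x) = - log (1 - (1 - x)) = Σ_{k ≥ 1} (1 - x) ^ k / k.
log1/ : (x : ℝ) → 0ᴿ <ᴿ x → x <ᴿ 1ᴿ → ℝ
log1/ x (e , 0<e , K , e≤x) (e′ , 0<e′ , L , x≤1-e′) =
  mkℝ (λ n → mercator (a n) n) λ ε 0<ε →
    let η        = ½ * (e * ε)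
        0<η      = 0<* 0<½ (0<* 0<e 0<ε)
        M , p    = cauchy x η 0<η
        N , hN≤η = archimedean η 0<η
        KL≤ : ∀ {n} → (K ℕ.⊔ L) ℕ.⊔ (M ℕ.⊔ N) ℕ.≤ n → K ℕ.⊔ L ℕ.≤ n
        KL≤ = ℕ.m⊔n≤o⇒m≤o (K ℕ.⊔ L) (M ℕ.⊔ N)
        MN≤ : ∀ {n} → (K ℕ.⊔ L) ℕ.⊔ (M ℕ.⊔ N) ℕ.≤ n → M ℕ.⊔ N ℕ.≤ n
        MN≤ = ℕ.m⊔n≤o⇒n≤o (K ℕ.⊔ L) (M ℕ.⊔ N)
        close : ∀ m n → (K ℕ.⊔ L) ℕ.⊔ (M ℕ.⊔ N) ℕ.≤ m → (K ℕ.⊔ L) ℕ.⊔ (M ℕ.⊔ N) ℕ.≤ n →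
                m ℕ.≤ n → ∣ mercator (a m) m - mercator (a n) n ∣ ≤ ε
        close = λ m n m≥ n≥ m≤n → *-cancelˡ-≤-pos e {{positive 0<e}} (subst
          (e * ∣ mercator (a m) m - mercator (a n) n ∣ ≤_) (half (e * ε))
          (mercator-close
            (0≤a m (ℕ.m⊔n≤o⇒n≤o K L (KL≤ m≥))) (a≤ m (ℕ.m⊔n≤o⇒m≤o K L (KL≤ m≥)))
            (0≤a n (ℕ.m⊔n≤o⇒n≤o K L (KL≤ n≥))) (a≤ n (ℕ.m⊔n≤o⇒m≤o K L (KL≤ n≥)))
            (<⇒≤ 0<e)
            (subst (_≤ η) (a-diff n m)
              (p n m (ℕ.m⊔n≤o⇒m≤o M N (MN≤ n≥)) (ℕ.m⊔n≤o⇒m≤o M N (MN≤ m≥))))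
            (≤-trans (h-anti (ℕ.m⊔n≤o⇒n≤o M N (MN≤ m≥))) hN≤η)
            m≤n))
    in (K ℕ.⊔ L) ℕ.⊔ (M ℕ.⊔ N) , λ m n m≥ n≥ → either m n (close m n m≥ n≥) (close n m n≥ m≥)
  where
  a : ℕ → ℚ
  a n = 1ℚ - seq x n

  0≤a : ∀ n → L ℕ.≤ n → 0ℚ ≤ a n
  0≤a n L≤n = p≤q⇒0≤q-p (≤-trans (by-slack {seq x n} e′ (<⇒≤ 0<e′) refl) (x≤1-e′ n L≤n))

  a≤ : ∀ n → K ℕ.≤ n → a n ≤ 1ℚ - e
  a≤ n K≤n = +-monoʳ-≤ 1ℚ (neg-antimono-≤ (subst (_≤ seq x n) (+-identityˡ e) (e≤x n K≤n)))

  a-diff : ∀ n m → ∣ seq x n - seq x m ∣ ≡ ∣ a m - a n ∣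
  a-diff n m = cong ∣_∣ (solve 2 (λ s t → s :- t := (con 1ℚ :- t) :- (con 1ℚ :- s)) refl (seq x n) (seq x m))

  either : ∀ m n {ε} → (m ℕ.≤ n → ∣ mercator (a m) m - mercator (a n) n ∣ ≤ ε) →
           (n ℕ.≤ m → ∣ mercator (a n) n - mercator (a m) m ∣ ≤ ε) →
           ∣ mercator (a m) m - mercator (a n) n ∣ ≤ ε
  either m n {ε} f g with ℕ.≤-total m n
  ... | inj₁ m≤n = f m≤n
  ... | inj₂ n≤m = subst (_≤ ε) (∣-∣-sym (mercator (a n) n) (mercator (a m) m)) (g n≤m)

-- A `Program r m` is run while some coin is arriving, with r further coins
-- still to come and m coins stored.  It never sees the identity or the bias of
-- a coin, only the outcomes of tosses; being a decision tree, it may depend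
-- arbitrarily on everything observed so far, so auxiliary information is free.
data Program : ℕ → ℕ → Set where
  tossArriving : ∀ {r m} → (Bool → Program r m) → Program r m
  tossStored   : ∀ {r m} → Fin m → (Bool → Program r m) → Program r m
  -- internal randomness: a uniform element of Fin (suc k)
  random       : ∀ {r m} k → (Fin (suc k) → Program r m) → Program r m
  -- store the arriving coin, which becomes number zero in memory
  store        : ∀ {r m} → Program r (suc m) → Program r m
  discard      : ∀ {r m} → Fin (suc m) → Program r m → Program r (suc m)
  -- let the arriving coin go and receive the next one
  next         : ∀ {r m} → Program r m → Program (suc r) m
  -- after the last coin, answer with a stored coin
  output       : ∀ {m} → Fin m → Program zero m

-- An algorithm for a stream of n coins starts, with empty memory, when the
-- first coin arrives.
data Algorithm : ℕ → Set where
  start : ∀ {r} → Program r 0 → Algorithm (suc r)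

maximum : ∀ {k} → Vector ℕ k → ℕ
maximum = foldr ℕ._⊔_ 0

-- Worst case over all toss outcomes and all internal randomness.
programTosses : ∀ {r m} → Program r m → ℕ
programTosses (tossArriving f) = suc (programTosses (f true) ℕ.⊔ programTosses (f false))
programTosses (tossStored _ f) = suc (programTosses (f true) ℕ.⊔ programTosses (f false))
programTosses (random _ f)     = maximum (λ i → programTosses (f i))
programTosses (store P)        = programTosses P
programTosses (discard _ P)    = programTosses P
programTosses (next P)         = programTosses P
programTosses (output _)       = 0

-- Largest number of coins stored at any point, again in the worst case.  It
-- suffices to inspect the memory just before a discard and at the output, since
-- the number of stored coins can only drop at a discard.
programMemory : ∀ {r m} → Program r m → ℕ
programMemory (tossArriving f)     = programMemory (f true) ℕ.⊔ programMemory (f false)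
programMemory (tossStored _ f)     = programMemory (f true) ℕ.⊔ programMemory (f false)
programMemory (random _ f)         = maximum (λ i → programMemory (f i))
programMemory (store P)            = programMemory P
programMemory {m = m} (discard _ P) = m ℕ.⊔ programMemory P
programMemory (next P)             = programMemory P
programMemory {m = m} (output _)   = m

tosses : ∀ {n} → Algorithm n → ℕ
tosses (start P) = programTosses P

memory : ∀ {n} → Algorithm n → ℕ
memory (start P) = programMemory P

module _ {n : ℕ} (bias : Fin n → ℝ) (target : Fin n) where

  -- Probability that the output is `target`, given the arriving coin, the coins
  -- still to come and the coins in memory.  Tosses are independent of each
  -- other and of the internal randomness.
  programProbability : ∀ {r m} → Program r m →
                       Fin n → Vec (Fin n) r → Vec (Fin n) m → ℝ
  programProbability (tossArriving f) c cs ms =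
    bias c *ᴿ programProbability (f true) c cs ms
      +ᴿ (1ᴿ -ᴿ bias c) *ᴿ programProbability (f false) c cs ms
  programProbability (tossStored i f) c cs ms =
    bias (lookup ms i) *ᴿ programProbability (f true) c cs ms
      +ᴿ (1ᴿ -ᴿ bias (lookup ms i)) *ᴿ programProbability (f false) c cs ms
  programProbability (random k f) c cs ms =
    fromℚ (+ 1 / suc k) *ᴿ Σᴿ (λ i → programProbability (f i) c cs ms)
  programProbability (store P) c cs ms = programProbability P c cs (c ∷ ms)
  programProbability (discard i P) c cs ms = programProbability P c cs (removeAt ms i)
  programProbability (next P) _ (c ∷ cs) ms = programProbability P c cs ms
  programProbability (output i) _ [] ms =
    if does (lookup ms i Fin.≟ target) then 1ᴿ else 0ᴿ

  streamProbability : ∀ {k} → Algorithm k → Vec (Fin n) k → ℝ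
  streamProbability (start P) (c ∷ cs) = programProbability P c cs []

-- Probability that the algorithm outputs the coin `target` when coin number
-- `order ⟨$⟩ʳ t` is the t-th to arrive.
outputProbability : ∀ {n} → Algorithm n → (Fin n → ℝ) → Permutation′ n → Fin n → ℝ
outputProbability A bias order target =
  streamProbability bias target A (tabulate (order ⟨$⟩ʳ_))

record MostBiasedWithGap {n} (bias : Fin n → ℝ) (best : Fin n) (Δ : ℝ) : Set where
  field
    second      : Fin n
    second≢best : second ≢ best
    best-max    : ∀ i → bias i ≤ᴿ bias best
    second-max  : ∀ i → i ≢ best → bias i ≤ᴿ bias second
    gap         : bias best -ᴿ bias second ≈ᴿ Δ

{-# OPTIONS --safe #-}

-- A knock-out tournament on a balanced binary tree, played while the coins arrive: every
-- opponent of the best coin is worse by Δ, so (J + d) * O(1 / Δ ^ 2) tosses bring the error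
-- of a match at level d below 2 ^ -(J + d).  The best coin plays one match per level, so its
-- errors add up to less than 2 * 2 ^ -J; there are about n / 2 ^ (d + 1) matches at level d,
-- so the tosses add up to O(J * n / Δ ^ 2); and only one coin per level has to be stored.
-- As log (1 / δ) → 0 for δ → 1, tossing all n coins is too expensive for large δ; there the
-- tournament is confined to a random window of about 2 * (1 - δ) * n consecutive coins.

module Submission where

open import Data.Bool.Base using (Bool; true; false; if_then_else_)
open import Data.Empty using (⊥-elim)
open import Data.Fin.Base using (Fin; zero; suc; toℕ; fromℕ<)
open import Data.Fin.Permutation using (Permutation′; _⟨$⟩ʳ_; _⟨$⟩ˡ_; inverseʳ)
import Data.Fin.Properties as Fin
open import Data.Nat.Base as ℕ using (ℕ; zero; suc)
import Data.Nat.DivMod as ℕ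
open import Data.Nat.Logarithm using (⌊log₂_⌋; ⌊log₂⌋-mono-≤; ⌊log₂[2^n]⌋≡n)
import Data.Nat.Properties as ℕ
open import Data.Nat.Solver using () renaming (module +-*-Solver to ℕ-Solver)
open import Data.Product.Base using (Σ-syntax; ∃-syntax; _×_; _,_; proj₁; proj₂)
open import Data.Rational.Base
open import Data.Rational.Properties
open import Data.Rational.Solver using (module +-*-Solver)
open import Data.Sum.Base using (_⊎_; inj₁; inj₂)
open import Data.Vec.Base using (Vec; []; _∷_; head; tail; lookup; removeAt; tabulate)
open import Data.Vec.Functional using (Vector; foldr)
open import Data.Vec.Properties using (lookup∘tabulate)
open import Function.Base using (_∘_)
open import Relation.Binary.PropositionalEquality
open import Relation.Nullary using (yes; no)
open import Relation.Nullary.Decidable.Core using (does; from-yes)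

open import Defs

open import Algebra.Definitions.RawSemiring +-*-rawSemiring using (_^_)
open +-*-Solver using (solve; _:+_; _:*_; _:-_; :-_; _:=_; con)
open ℕ-Solver using ()
  renaming (solve to ℕ-solve; con to ℕ-con; _:+_ to _:+ℕ_; _:*_ to _:*ℕ_; _:=_ to _:=ℕ_)

-- Rational arithmetic and the series of log (1 / δ)

-- The reals are Cauchy sequences whose order is undecidable, so δ cannot be compared with ½ and Δ
-- cannot be rounded. Every parameter is instead read off rationals `D` and `D′` that agree with Δ,
-- with δ and (for `1 - D′`) with 1 - δ up to a factor of two, which disappears in the constant. A
-- program makes boundedly many tosses, so its success probability is a polynomial in the biases. It
-- is bounded for rational biases and transferred to real ones by a Lipschitz estimate, whose
-- constant may be huge because it is only ever played off against an arbitrary ε. No exponential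
-- function occurs: the error of a match is controlled by a Chernoff bound in polynomial form, and
-- Bernoulli's inequality takes the place of exp. Where log (1 / δ) vanishes, the budget may not
-- allow even one toss. Hence a tournament of k coins must cost in proportion to k - 1, not k: a
-- window can shrink to a single coin, which is then guessed untossed.

q-p≥0⇒p≤q : ∀ {p q} → 0ℚ ≤ q - p → p ≤ q
q-p≥0⇒p≤q {p} {q} 0≤ = by-slack (q - p) 0≤ (solve 2 (λ p q → p :+ (q :- p) := q) refl p q)

¼ ⅛ 2ℚ : ℚ
¼ = ½ * ½
⅛ = ½ * ¼
2ℚ = 1ℚ + 1ℚ

0≤1 : 0ℚ ≤ 1ℚ
0≤1 = from-yes (0ℚ ≤? 1ℚ)

0≤½ : 0ℚ ≤ ½
0≤½ = <⇒≤ 0<½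

0<1 : 0ℚ < 1ℚ
0<1 = from-yes (0ℚ <? 1ℚ)

ι-+ : ∀ m n → ι (m ℕ.+ n) ≡ ι m + ι n
ι-+ zero    n = sym (+-identityˡ (ι n))
ι-+ (suc m) n = begin-equality
  ι (suc (m ℕ.+ n))   ≡⟨ ι-suc (m ℕ.+ n) ⟩
  1ℚ + ι (m ℕ.+ n)    ≡⟨ cong (1ℚ +_) (ι-+ m n) ⟩
  1ℚ + (ι m + ι n)    ≡⟨ +-assoc 1ℚ (ι m) (ι n) ⟨
  (1ℚ + ι m) + ι n    ≡⟨ cong (_+ ι n) (ι-suc m) ⟨
  ι (suc m) + ι n     ∎
  where open ≤-Reasoning

ι-* : ∀ m n → ι (m ℕ.* n) ≡ ι m * ι n
ι-* zero    n = sym (*-zeroˡ (ι n))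
ι-* (suc m) n = begin-equality
  ι (n ℕ.+ m ℕ.* n)   ≡⟨ ι-+ n (m ℕ.* n) ⟩
  ι n + ι (m ℕ.* n)   ≡⟨ cong (_+_ (ι n)) (ι-* m n) ⟩
  ι n + ι m * ι n     ≡⟨ solve 2 (λ m n → n :+ m :* n := (con 1ℚ :+ m) :* n) refl (ι m) (ι n) ⟩
  (1ℚ + ι m) * ι n    ≡⟨ cong (_* ι n) (ι-suc m) ⟨
  ι (suc m) * ι n     ∎
  where open ≤-Reasoning

0≤ι : ∀ n → 0ℚ ≤ ι n
0≤ι zero    = ≤-refl
0≤ι (suc n) = subst (0ℚ ≤_) (sym (ι-suc n)) (0≤+ 0≤1 (0≤ι n))

ι-mono : ∀ {m n} → m ℕ.≤ n → ι m ≤ ι n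
ι-mono {m} {n} m≤n = by-slack (ι (n ℕ.∸ m)) (0≤ι (n ℕ.∸ m))
  (trans (sym (ι-+ m (n ℕ.∸ m))) (cong ι (ℕ.m+[n∸m]≡n m≤n)))

^-+ : ∀ a m n → a ^ (m ℕ.+ n) ≡ a ^ m * a ^ n
^-+ a zero    n = sym (*-identityˡ (a ^ n))
^-+ a (suc m) n = trans (cong (a *_) (^-+ a m n)) (sym (*-assoc a (a ^ m) (a ^ n)))

^-anti-≤ : ∀ {a m n} → 0ℚ ≤ a → a ≤ 1ℚ → m ℕ.≤ n → a ^ n ≤ a ^ m
^-anti-≤ {a} {m} {n} 0≤a a≤1 m≤n = begin
  a ^ n                      ≡⟨ cong (a ^_) (ℕ.m+[n∸m]≡n m≤n) ⟨
  a ^ (m ℕ.+ (n ℕ.∸ m))      ≡⟨ ^-+ a m (n ℕ.∸ m) ⟩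
  a ^ m * a ^ (n ℕ.∸ m)      ≤⟨ *-monoˡ (a ^ m) (0≤^ m 0≤a) (^≤1 (n ℕ.∸ m) 0≤a a≤1) ⟩
  a ^ m * 1ℚ                 ≡⟨ *-identityʳ (a ^ m) ⟩
  a ^ m                      ∎
  where open ≤-Reasoning

^-*-≤ : ∀ {a b} k j → 0ℚ ≤ a → a ^ k ≤ b → a ^ (j ℕ.* k) ≤ b ^ j
^-*-≤ {a} {b} k zero    0≤a aᵏ≤b = ≤-refl
^-*-≤ {a} {b} k (suc j) 0≤a aᵏ≤b = begin
  a ^ (k ℕ.+ j ℕ.* k)    ≡⟨ ^-+ a k (j ℕ.* k) ⟩
  a ^ k * a ^ (j ℕ.* k)  ≤⟨ *-monoˡ (a ^ k) (0≤^ k 0≤a) (^-*-≤ k j 0≤a aᵏ≤b) ⟩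
  a ^ k * b ^ j          ≤⟨ *-monoʳ (b ^ j) (0≤^ j (≤-trans (0≤^ k 0≤a) aᵏ≤b)) aᵏ≤b ⟩
  b * b ^ j              ∎
  where open ≤-Reasoning

h≤1 : ∀ k → h k ≤ 1ℚ
h≤1 k = h-anti {0} {k} ℕ.z≤n

h≤2h : ∀ k → h k ≤ 2ℚ * h (suc k)
h≤2h k = begin
  h k                                 ≡⟨ *-identityʳ (h k) ⟨
  h k * 1ℚ                            ≡⟨ cong (h k *_) (h*ι (suc k)) ⟨
  h k * (h (suc k) * ι (suc (suc k))) ≡⟨ cong (λ t → h k * (h (suc k) * t)) (ι-suc (suc k)) ⟩
  h k * (h (suc k) * (1ℚ + ι (suc k)))
    ≡⟨ solve 3 (λ x y i → x :* (y :* (con 1ℚ :+ i)) := (x :+ x :* i) :* y) refl (h k) (h (suc k)) (ι (suc k)) ⟩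
  (h k + h k * ι (suc k)) * h (suc k) ≡⟨ cong (λ t → (h k + t) * h (suc k)) (h*ι k) ⟩
  (h k + 1ℚ) * h (suc k)              ≤⟨ *-monoʳ (h (suc k)) (0≤h (suc k)) (+-monoˡ-≤ 1ℚ (h≤1 k)) ⟩
  2ℚ * h (suc k)                      ∎
  where open ≤-Reasoning

½^≤h : ∀ k → ½ ^ k ≤ h k
½^≤h zero    = ≤-refl
½^≤h (suc k) = begin
  ½ * ½ ^ k            ≤⟨ *-monoˡ ½ 0≤½ (≤-trans (½^≤h k) (h≤2h k)) ⟩
  ½ * (2ℚ * h (suc k)) ≡⟨ solve 1 (λ x → con ½ :* (con 2ℚ :* x) := x) refl (h (suc k)) ⟩
  h (suc k)            ∎
  where open ≤-Reasoning

ι2^*½^ : ∀ k → ι (2 ℕ.^ k) * ½ ^ k ≡ 1ℚ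
ι2^*½^ zero    = refl
ι2^*½^ (suc k) = begin-equality
  ι (2 ℕ.* 2 ℕ.^ k) * (½ * ½ ^ k)   ≡⟨ cong (_* (½ * ½ ^ k)) (ι-* 2 (2 ℕ.^ k)) ⟩
  (2ℚ * ι (2 ℕ.^ k)) * (½ * ½ ^ k)  ≡⟨ solve 2 (λ x y → (con 2ℚ :* x) :* (con ½ :* y) := x :* y) refl (ι (2 ℕ.^ k)) (½ ^ k) ⟩
  ι (2 ℕ.^ k) * ½ ^ k               ≡⟨ ι2^*½^ k ⟩
  1ℚ                                ∎
  where open ≤-Reasoning

-- A downward search from `N` for the place where `f` crosses `x`. It turns rational data into the
-- integer parameters `R`, `J` and `m`.
bracket : ∀ (f : ℕ → ℚ) {x} → f 1 ≤ f 0 → ∀ N → x ≤ f 0 → f N ≤ x → ∃[ k ] (x ≤ f k × f (suc k) ≤ x)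
bracket f f1≤f0 zero    x≤f0 f0≤x = 0 , x≤f0 , ≤-trans f1≤f0 f0≤x
bracket f {x} f1≤f0 (suc N) x≤f0 fN≤x with ≤-total x (f N)
... | inj₁ x≤fN = N , x≤fN , fN≤x
... | inj₂ fN≤x′ = bracket f f1≤f0 N x≤f0 fN≤x′

-- Bernoulli's inequality, its upper counterpart and exponents that halve

bernoulli : ∀ {x} → 0ℚ ≤ x → x ≤ 1ℚ → ∀ n → 1ℚ - ι n * x ≤ (1ℚ - x) ^ n
bernoulli {x} 0≤x x≤1 zero    = ≤-reflexive (solve 1 (λ x → con 1ℚ :- con 0ℚ :* x := con 1ℚ) refl x)
bernoulli {x} 0≤x x≤1 (suc n) = begin
  1ℚ - ι (suc n) * x          ≡⟨ cong (λ t → 1ℚ - t * x) (ι-suc n) ⟩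
  1ℚ - (1ℚ + ι n) * x         ≤⟨ by-slack (ι n * (x * x)) (0≤* (0≤ι n) (0≤* 0≤x 0≤x))
                                   (solve 2 (λ x n → (con 1ℚ :- (con 1ℚ :+ n) :* x) :+ n :* (x :* x) := (con 1ℚ :- x) :* (con 1ℚ :- n :* x)) refl x (ι n)) ⟩
  (1ℚ - x) * (1ℚ - ι n * x)   ≤⟨ *-monoˡ (1ℚ - x) (p≤q⇒0≤q-p x≤1) (bernoulli 0≤x x≤1 n) ⟩
  (1ℚ - x) * (1ℚ - x) ^ n     ∎
  where open ≤-Reasoning

-- Stands in for (1 - x) ^ n ≤ exp (- n x), with exp y weakened to 1 + y and the division cleared.
bernoulli-upper : ∀ {x} → 0ℚ ≤ x → x ≤ 1ℚ → ∀ n → (1ℚ - x) ^ n * (1ℚ + ι n * x) ≤ 1ℚ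
bernoulli-upper {x} 0≤x x≤1 zero    = ≤-reflexive (solve 1 (λ x → con 1ℚ :* (con 1ℚ :+ con 0ℚ :* x) := con 1ℚ) refl x)
bernoulli-upper {x} 0≤x x≤1 (suc n) = begin
  (y * P) * (1ℚ + ι (suc n) * x)      ≡⟨ cong (λ t → (y * P) * (1ℚ + t * x)) (ι-suc n) ⟩
  (y * P) * (1ℚ + (1ℚ + ι n) * x)
    ≤⟨ by-slack (P * ((1ℚ + ι n) * (x * x))) (0≤* 0≤P (0≤* (0≤+ 0≤1 (0≤ι n)) (0≤* 0≤x 0≤x)))
         (solve 3 (λ x n P → ((con 1ℚ :- x) :* P) :* (con 1ℚ :+ (con 1ℚ :+ n) :* x) :+ P :* ((con 1ℚ :+ n) :* (x :* x)) := P :* (con 1ℚ :+ n :* x)) refl x (ι n) P) ⟩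
  P * (1ℚ + ι n * x)                  ≤⟨ bernoulli-upper 0≤x x≤1 n ⟩
  1ℚ                                  ∎
  where
  open ≤-Reasoning
  y P : ℚ
  y = 1ℚ - x
  P = y ^ n
  0≤P : 0ℚ ≤ P
  0≤P = 0≤^ n (p≤q⇒0≤q-p x≤1)

halving-exponent : ∀ {x} → 0ℚ < x → x ≤ 1ℚ → ∃[ R ] (ι R * x ≤ 2ℚ × (1ℚ - x) ^ R ≤ ½)
halving-exponent {x} 0<x x≤1 with archimedean x 0<x
... | N , hN≤x with bracket h (h-anti {0} {1} ℕ.z≤n) N x≤1 hN≤x
... | k , x≤hk , hk≤x = R , Rx≤2 , (begin
  P                             ≡⟨ half P ⟨
  ½ * P + ½ * P                 ≡⟨ solve 1 (λ P → con ½ :* P :+ con ½ :* P := con ½ :* (P :* (con 1ℚ :+ con 1ℚ))) refl P ⟩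
  ½ * (P * (1ℚ + 1ℚ))           ≤⟨ *-monoˡ ½ 0≤½ (*-monoˡ P 0≤P (+-monoʳ-≤ 1ℚ 1≤Rx)) ⟩
  ½ * (P * (1ℚ + ι R * x))      ≤⟨ *-monoˡ ½ 0≤½ (bernoulli-upper (<⇒≤ 0<x) x≤1 R) ⟩
  ½ * 1ℚ                        ≡⟨ *-identityʳ ½ ⟩
  ½ ∎)
  where
  open ≤-Reasoning
  -- From 1 / (k + 2) ≤ x ≤ 1 / (k + 1) follows 1 ≤ R x ≤ 2: large enough for a halving, yet O(1 /
  -- x).
  R : ℕ
  R = suc (suc k)
  P : ℚ
  P = (1ℚ - x) ^ R
  0≤P : 0ℚ ≤ P
  0≤P = 0≤^ R (p≤q⇒0≤q-p x≤1)
  1≤Rx : 1ℚ ≤ ι R * x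
  1≤Rx = begin
    1ℚ                  ≡⟨ h*ι (suc k) ⟨
    h (suc k) * ι R     ≡⟨ *-comm (h (suc k)) (ι R) ⟩
    ι R * h (suc k)     ≤⟨ *-monoˡ (ι R) (0≤ι R) hk≤x ⟩
    ι R * x             ∎
  Rx≤2 : ι R * x ≤ 2ℚ
  Rx≤2 = begin
    ι R * x                   ≤⟨ *-monoˡ (ι R) (0≤ι R) (≤-trans x≤hk (h≤2h k)) ⟩
    ι R * (2ℚ * h (suc k))    ≡⟨ solve 2 (λ r y → r :* (con 2ℚ :* y) := con 2ℚ :* (y :* r)) refl (ι R) (h (suc k)) ⟩
    2ℚ * (h (suc k) * ι R)    ≡⟨ cong (2ℚ *_) (h*ι (suc k)) ⟩
    2ℚ                        ∎

-- The terms of the series decrease, so each of the `p` terms after the first `N` is at least the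
-- one with exponent `suc M`.
mercator-≥-sum : ∀ {a} → 0ℚ ≤ a → a ≤ 1ℚ → ∀ p N M → p ℕ.+ N ℕ.≤ suc M →
                 mercator a N + ι p * (a ^ suc M * h M) ≤ mercator a (p ℕ.+ N)
mercator-≥-sum {a} 0≤a a≤1 zero    N M _ = ≤-reflexive
  (solve 2 (λ m t → m :+ con 0ℚ :* t := m) refl (mercator a N) (a ^ suc M * h M))
mercator-≥-sum {a} 0≤a a≤1 (suc p) N M p+N<M = begin
  mercator a N + ι (suc p) * t     ≡⟨ cong (λ i → mercator a N + i * t) (ι-suc p) ⟩
  mercator a N + (1ℚ + ι p) * t    ≡⟨ solve 3 (λ m i t → m :+ (con 1ℚ :+ i) :* t := (m :+ i :* t) :+ t) refl (mercator a N) (ι p) t ⟩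
  (mercator a N + ι p * t) + t     ≤⟨ +-mono-≤ (mercator-≥-sum 0≤a a≤1 p N M (ℕ.<⇒≤ p+N<M)) t≤ ⟩
  mercator a (p ℕ.+ N) + a ^ suc (p ℕ.+ N) * h (p ℕ.+ N) ∎
  where
  open ≤-Reasoning
  t : ℚ
  t = a ^ suc M * h M
  t≤ : t ≤ a ^ suc (p ℕ.+ N) * h (p ℕ.+ N)
  t≤ = ≤-trans (*-monoʳ (h M) (0≤h M) (^-anti-≤ 0≤a a≤1 p+N<M))
               (*-monoˡ (a ^ suc (p ℕ.+ N)) (0≤^ (suc (p ℕ.+ N)) 0≤a) (h-anti (ℕ.s≤s⁻¹ p+N<M)))

-- Cauchy condensation: the block has N terms, each at least a ^ (2 N) / (2 N).
mercator-double : ∀ {a} → 0ℚ ≤ a → a ≤ 1ℚ → ∀ N → 1 ℕ.≤ N →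
                  mercator a N + ½ * a ^ (2 ℕ.* N) ≤ mercator a (2 ℕ.* N)
mercator-double {a} 0≤a a≤1 (suc n) _ = subst₂ _≤_
  (cong (_+_ (mercator a N)) (begin-equality
    ι N * (a ^ (2 ℕ.* N) * h M)         ≡⟨ solve 3 (λ i A x → i :* (A :* x) := con ½ :* A :* (x :* (i :+ i))) refl (ι N) (a ^ (2 ℕ.* N)) (h M) ⟩
    ½ * a ^ (2 ℕ.* N) * (h M * (ι N + ι N)) ≡⟨ cong (λ t → ½ * a ^ (2 ℕ.* N) * (h M * t)) (trans (sym (ι-+ N N)) (cong ι N+N)) ⟩
    ½ * a ^ (2 ℕ.* N) * (h M * ι (suc M))   ≡⟨ cong (½ * a ^ (2 ℕ.* N) *_) (h*ι M) ⟩
    ½ * a ^ (2 ℕ.* N) * 1ℚ              ≡⟨ *-identityʳ _ ⟩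
    ½ * a ^ (2 ℕ.* N)                   ∎))
  (cong (mercator a) N+N)
  (mercator-≥-sum 0≤a a≤1 N N M (ℕ.≤-reflexive N+N))
  where
  open ≤-Reasoning
  N M : ℕ
  N = suc n
  M = n ℕ.+ (N ℕ.+ 0)
  N+N : N ℕ.+ N ≡ suc M
  N+N = cong (N ℕ.+_) (sym (ℕ.+-identityʳ N))

-- Each of the dyadic blocks 2 ^ m < k ≤ 2 ^ suc m with m ≤ i contributes at least
-- a ^ 2 ^ suc i / 2 to the series, and a ^ 2 ^ suc i ≥ (1 - ½ ^ suc i) ^ 2 ^ suc i ≥ ¼.
mercator-≥-⅛ : ∀ {a} i → 1ℚ - ½ ^ suc i ≤ a → a ≤ 1ℚ → ∀ {k} → 2 ℕ.^ suc i ℕ.≤ k →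
               ι (suc i) * ⅛ ≤ mercator a k
mercator-≥-⅛ {a} i ≤a a≤1 {k} 2^≤k = begin
  ι (suc i) * ⅛               ≤⟨ blocks (suc i) ℕ.≤-refl ⟩
  mercator a (2 ℕ.^ suc i)    ≤⟨ mercator-mono 0≤a (2 ℕ.^ suc i) (k ℕ.∸ 2 ℕ.^ suc i) ⟩
  mercator a (k ℕ.∸ 2 ℕ.^ suc i ℕ.+ 2 ℕ.^ suc i) ≡⟨ cong (mercator a) (ℕ.m∸n+n≡m 2^≤k) ⟩
  mercator a k                ∎
  where
  open ≤-Reasoning
  b : ℚ
  b = 1ℚ - ½ ^ suc i
  0≤½^ : 0ℚ ≤ ½ ^ suc i
  0≤½^ = 0≤^ (suc i) 0≤½
  ½^≤1 : ½ ^ suc i ≤ 1ℚ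
  ½^≤1 = ^≤1 (suc i) 0≤½ (from-yes (½ ≤? 1ℚ))
  0≤b : 0ℚ ≤ b
  0≤b = p≤q⇒0≤q-p ½^≤1
  0≤a : 0ℚ ≤ a
  0≤a = ≤-trans 0≤b ≤a
  ½≤ : ½ ≤ b ^ (2 ℕ.^ i)
  ½≤ = begin
    ½                                 ≡⟨⟩
    1ℚ - ½ * 1ℚ                       ≡⟨ cong (λ t → 1ℚ - ½ * t) (ι2^*½^ i) ⟨
    1ℚ - ½ * (ι (2 ℕ.^ i) * ½ ^ i)    ≡⟨ cong (λ t → 1ℚ - t) (solve 2 (λ x y → con ½ :* (x :* y) := x :* (con ½ :* y)) refl (ι (2 ℕ.^ i)) (½ ^ i)) ⟩
    1ℚ - ι (2 ℕ.^ i) * ½ ^ suc i      ≤⟨ bernoulli 0≤½^ ½^≤1 (2 ℕ.^ i) ⟩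
    b ^ (2 ℕ.^ i)                     ∎
  ¼≤ : ¼ ≤ a ^ (2 ℕ.^ suc i)
  ¼≤ = begin
    ½ * ½                             ≤⟨ *-monoˡ ½ 0≤½ ½≤ ⟩
    ½ * b ^ (2 ℕ.^ i)                 ≤⟨ *-monoʳ _ (0≤^ (2 ℕ.^ i) 0≤b) ½≤ ⟩
    b ^ (2 ℕ.^ i) * b ^ (2 ℕ.^ i)     ≡⟨ ^-+ b (2 ℕ.^ i) (2 ℕ.^ i) ⟨
    b ^ (2 ℕ.^ i ℕ.+ 2 ℕ.^ i)         ≡⟨ cong (λ t → b ^ (2 ℕ.^ i ℕ.+ t)) (ℕ.+-identityʳ (2 ℕ.^ i)) ⟨
    b ^ (2 ℕ.^ suc i)                 ≤⟨ ^-mono (2 ℕ.^ suc i) 0≤b ≤a ⟩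
    a ^ (2 ℕ.^ suc i)                 ∎
  blocks : ∀ m → m ℕ.≤ suc i → ι m * ⅛ ≤ mercator a (2 ℕ.^ m)
  blocks zero    _   = mercator-mono 0≤a 0 1
  blocks (suc m) m<i = begin
    ι (suc m) * ⅛                           ≡⟨ cong (_* ⅛) (ι-suc m) ⟩
    (1ℚ + ι m) * ⅛                          ≡⟨ solve 1 (λ m → (con 1ℚ :+ m) :* con ⅛ := m :* con ⅛ :+ con ½ :* con ¼) refl (ι m) ⟩
    ι m * ⅛ + ½ * ¼                         ≤⟨ +-mono-≤ (blocks m (ℕ.<⇒≤ m<i))
                                                 (*-monoˡ ½ 0≤½ (≤-trans ¼≤ (^-anti-≤ 0≤a a≤1 (ℕ.^-monoʳ-≤ 2 m<i)))) ⟩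
    mercator a (2 ℕ.^ m) + ½ * a ^ (2 ℕ.^ suc m) ≤⟨ mercator-double 0≤a a≤1 (2 ℕ.^ m) (ℕ.m^n>0 2 m) ⟩
    mercator a (2 ℕ.^ suc m) ∎

mercator-≥ : ∀ {a} → 0ℚ ≤ a → ∀ {k} → 1 ℕ.≤ k → a ≤ mercator a k
mercator-≥ {a} 0≤a {k} 1≤k = begin
  a                           ≡⟨ solve 1 (λ a → a := con 0ℚ :+ a :* con 1ℚ :* con 1ℚ) refl a ⟩
  mercator a 1                ≤⟨ mercator-mono 0≤a 1 (k ℕ.∸ 1) ⟩
  mercator a (k ℕ.∸ 1 ℕ.+ 1)  ≡⟨ cong (mercator a) (ℕ.m∸n+n≡m 1≤k) ⟩
  mercator a k                ∎
  where open ≤-Reasoning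

-- Success probabilities for rational biases

Σℚ : ∀ {k} → Vector ℚ k → ℚ
Σℚ = foldr _+_ 0ℚ

seq-Σ : ∀ {k} (v : Vector ℝ k) j → seq (Σᴿ v) j ≡ Σℚ (λ i → seq (v i) j)
seq-Σ {zero}  v j = refl
seq-Σ {suc k} v j = cong (_+_ (seq (v zero) j)) (seq-Σ (v ∘ suc) j)

Σℚ-cong : ∀ {k} {v w : Vector ℚ k} → (∀ i → v i ≡ w i) → Σℚ v ≡ Σℚ w
Σℚ-cong {zero}  v≡w = refl
Σℚ-cong {suc k} v≡w = cong₂ _+_ (v≡w zero) (Σℚ-cong (v≡w ∘ suc))

0≤Σℚ : ∀ {k} {v : Vector ℚ k} → (∀ i → 0ℚ ≤ v i) → 0ℚ ≤ Σℚ v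
0≤Σℚ {zero}  0≤v = ≤-refl
0≤Σℚ {suc k} 0≤v = 0≤+ (0≤v zero) (0≤Σℚ (0≤v ∘ suc))

Σℚ≤ι : ∀ {k} {v : Vector ℚ k} → (∀ i → v i ≤ 1ℚ) → Σℚ v ≤ ι k
Σℚ≤ι {zero}      v≤1 = ≤-refl
Σℚ≤ι {suc k} {v} v≤1 = subst (Σℚ v ≤_) (sym (ι-suc k)) (+-mono-≤ (v≤1 zero) (Σℚ≤ι (v≤1 ∘ suc)))

≤Σℚ : ∀ {k} {v : Vector ℚ k} → (∀ i → 0ℚ ≤ v i) → ∀ i → v i ≤ Σℚ v
≤Σℚ {v = v} 0≤v zero    = by-slack (Σℚ (v ∘ suc)) (0≤Σℚ (0≤v ∘ suc)) refl
≤Σℚ {v = v} 0≤v (suc i) = ≤-trans (≤Σℚ (0≤v ∘ suc) i) (by-slack (v zero) (0≤v zero) (+-comm (Σℚ (v ∘ suc)) (v zero)))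

∣Σℚ-Σℚ∣≤ : ∀ {k} {v w l : Vector ℚ k} {η} → (∀ i → ∣ v i - w i ∣ ≤ l i * η) →
           ∣ Σℚ v - Σℚ w ∣ ≤ Σℚ l * η
∣Σℚ-Σℚ∣≤ {zero}  {η = η} _ = ≤-reflexive (sym (*-zeroˡ η))
∣Σℚ-Σℚ∣≤ {suc k} {v} {w} {l} {η} close = begin
  ∣ (v zero + V) - (w zero + W) ∣
    ≡⟨ cong ∣_∣ (solve 4 (λ a b c d → (a :+ b) :- (c :+ d) := (a :- c) :+ (b :- d)) refl (v zero) V (w zero) W) ⟩
  ∣ (v zero - w zero) + (V - W) ∣  ≤⟨ ∣p+q∣≤∣p∣+∣q∣ (v zero - w zero) (V - W) ⟩
  ∣ v zero - w zero ∣ + ∣ V - W ∣  ≤⟨ +-mono-≤ (close zero) (∣Σℚ-Σℚ∣≤ (close ∘ suc)) ⟩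
  l zero * η + Σℚ (l ∘ suc) * η    ≡⟨ *-distribʳ-+ η (l zero) (Σℚ (l ∘ suc)) ⟨
  (l zero + Σℚ (l ∘ suc)) * η      ∎
  where
  open ≤-Reasoning
  V W : ℚ
  V = Σℚ (v ∘ suc)
  W = Σℚ (w ∘ suc)

InUnit : ℚ → Set
InUnit p = 0ℚ ≤ p × p ≤ 1ℚ

mix : ℚ → ℚ → ℚ → ℚ
mix p x y = p * x + (1ℚ - p) * y

mix-mono : ∀ {p x x′ y y′} → InUnit p → x ≤ x′ → y ≤ y′ → mix p x y ≤ mix p x′ y′
mix-mono {p} (0≤p , p≤1) x≤ y≤ = +-mono-≤ (*-monoˡ p 0≤p x≤) (*-monoˡ (1ℚ - p) (p≤q⇒0≤q-p p≤1) y≤)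

mix-idem : ∀ p x → mix p x x ≡ x
mix-idem = solve 2 (λ p x → p :* x :+ (con 1ℚ :- p) :* x := x) refl

≤mix : ∀ {p v x y} → InUnit p → v ≤ x → v ≤ y → v ≤ mix p x y
≤mix {p} {v} p∈ v≤x v≤y = subst (_≤ mix p _ _) (mix-idem p v) (mix-mono p∈ v≤x v≤y)

mix≤ : ∀ {p v x y} → InUnit p → x ≤ v → y ≤ v → mix p x y ≤ v
mix≤ {p} {v} p∈ x≤v y≤v = subst (mix p _ _ ≤_) (mix-idem p v) (mix-mono p∈ x≤v y≤v)

∣p∣≤1 : ∀ {p} → InUnit p → ∣ p ∣ ≤ 1ℚ
∣p∣≤1 (0≤p , p≤1) = subst (_≤ 1ℚ) (sym (0≤p⇒∣p∣≡p 0≤p)) p≤1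

1-∈ : ∀ {p} → InUnit p → InUnit (1ℚ - p)
1-∈ {p} (0≤p , p≤1) = p≤q⇒0≤q-p p≤1 , by-slack p 0≤p (solve 1 (λ p → (con 1ℚ :- p) :+ p := con 1ℚ) refl p)

∣x-y∣≤1 : ∀ {x y} → InUnit x → InUnit y → ∣ x - y ∣ ≤ 1ℚ
∣x-y∣≤1 {x} {y} (0≤x , x≤1) (0≤y , y≤1) with ≤-total y x
... | inj₁ y≤x = subst (_≤ 1ℚ) (sym (0≤p⇒∣p∣≡p (p≤q⇒0≤q-p y≤x)))
  (≤-trans (by-slack y 0≤y (solve 2 (λ x y → (x :- y) :+ y := x) refl x y)) x≤1)
... | inj₂ x≤y = subst (_≤ 1ℚ) (trans (sym (0≤p⇒∣p∣≡p (p≤q⇒0≤q-p x≤y))) (∣-∣-sym y x))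
  (≤-trans (by-slack x 0≤x (solve 2 (λ x y → (y :- x) :+ x := y) refl x y)) y≤1)

-- Only the primed values are probabilities; an approximant `p` may leave the unit interval by up to
-- η ≤ 1. Hence the bound 2 on the sizes of `p` and `1ℚ - p`, and the factor `2ℚ`.
mix-lipschitz : ∀ {p p′ x x′ y y′ k l η} → InUnit p′ → InUnit x′ → InUnit y′ → η ≤ 1ℚ →
                ∣ p - p′ ∣ ≤ η → ∣ x - x′ ∣ ≤ k * η → ∣ y - y′ ∣ ≤ l * η →
                ∣ mix p x y - mix p′ x′ y′ ∣ ≤ (2ℚ * (k + l) + 1ℚ) * η
mix-lipschitz {p} {p′} {x} {x′} {y} {y′} {k} {l} {η} p′∈ x′∈ y′∈ η≤1 p≈ x≈ y≈ = begin
  ∣ mix p x y - mix p′ x′ y′ ∣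
    ≡⟨ cong ∣_∣ (solve 6 (λ p p′ x x′ y y′ →
         (p :* x :+ (con 1ℚ :- p) :* y) :- (p′ :* x′ :+ (con 1ℚ :- p′) :* y′)
         := (p :* (x :- x′) :+ (con 1ℚ :- p) :* (y :- y′)) :+ (p :- p′) :* (x′ :- y′)) refl p p′ x x′ y y′) ⟩
  ∣ (p * A + (1ℚ - p) * B) + (p - p′) * (x′ - y′) ∣
    ≤⟨ ≤-trans (∣p+q∣≤∣p∣+∣q∣ (p * A + (1ℚ - p) * B) ((p - p′) * (x′ - y′)))
               (+-monoˡ-≤ ∣ (p - p′) * (x′ - y′) ∣ (∣p+q∣≤∣p∣+∣q∣ (p * A) ((1ℚ - p) * B))) ⟩
  (∣ p * A ∣ + ∣ (1ℚ - p) * B ∣) + ∣ (p - p′) * (x′ - y′) ∣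
    ≡⟨ cong₂ _+_ (cong₂ _+_ (∣p*q∣≡∣p∣*∣q∣ p A) (∣p*q∣≡∣p∣*∣q∣ (1ℚ - p) B)) (∣p*q∣≡∣p∣*∣q∣ (p - p′) (x′ - y′)) ⟩
  (∣ p ∣ * ∣ A ∣ + ∣ 1ℚ - p ∣ * ∣ B ∣) + ∣ p - p′ ∣ * ∣ x′ - y′ ∣
    ≤⟨ +-mono-≤ (+-mono-≤ (*-≤ ∣p∣≤2 x≈ (0≤∣p∣ p)) (*-≤ ∣1-p∣≤2 y≈ (0≤∣p∣ (1ℚ - p))))
                (*-≤ p≈ (∣x-y∣≤1 x′∈ y′∈) (0≤∣p∣ (p - p′))) ⟩
  (2ℚ * (k * η) + 2ℚ * (l * η)) + η * 1ℚ
    ≡⟨ solve 3 (λ k l η → (con 2ℚ :* (k :* η) :+ con 2ℚ :* (l :* η)) :+ η :* con 1ℚ := (con 2ℚ :* (k :+ l) :+ con 1ℚ) :* η) refl k l η ⟩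
  (2ℚ * (k + l) + 1ℚ) * η ∎
  where
  open ≤-Reasoning
  A B : ℚ
  A = x - x′
  B = y - y′
  *-≤ : ∀ {u v z w} → u ≤ v → ∣ z ∣ ≤ w → 0ℚ ≤ u → u * ∣ z ∣ ≤ v * w
  *-≤ {u} {v} {z} u≤v z≤w 0≤u = ≤-trans (*-monoʳ ∣ z ∣ (0≤∣p∣ z) u≤v) (*-monoˡ v (≤-trans 0≤u u≤v) z≤w)
  ∣p∣≤2 : ∣ p ∣ ≤ 2ℚ
  ∣p∣≤2 = begin
    ∣ p ∣                  ≡⟨ cong ∣_∣ (solve 2 (λ p p′ → p := p′ :+ (p :- p′)) refl p p′) ⟩
    ∣ p′ + (p - p′) ∣      ≤⟨ ∣p+q∣≤∣p∣+∣q∣ p′ (p - p′) ⟩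
    ∣ p′ ∣ + ∣ p - p′ ∣    ≤⟨ +-mono-≤ (∣p∣≤1 p′∈) (≤-trans p≈ η≤1) ⟩
    2ℚ                     ∎
  ∣1-p∣≤2 : ∣ 1ℚ - p ∣ ≤ 2ℚ
  ∣1-p∣≤2 = begin
    ∣ 1ℚ - p ∣                     ≡⟨ cong ∣_∣ (solve 2 (λ p p′ → con 1ℚ :- p := (con 1ℚ :- p′) :+ (p′ :- p)) refl p p′) ⟩
    ∣ (1ℚ - p′) + (p′ - p) ∣       ≤⟨ ∣p+q∣≤∣p∣+∣q∣ (1ℚ - p′) (p′ - p) ⟩
    ∣ 1ℚ - p′ ∣ + ∣ p′ - p ∣       ≤⟨ +-mono-≤ (∣p∣≤1 (1-∈ p′∈)) (subst (_≤ 1ℚ) (∣-∣-sym p p′) (≤-trans p≈ η≤1)) ⟩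
    2ℚ                             ∎

module _ {n : ℕ} (bias : Fin n → ℚ) (target : Fin n) where

  probability : ∀ {r m} → Program r m → Fin n → Vec (Fin n) r → Vec (Fin n) m → ℚ
  probability (tossArriving f) c cs ms =
    mix (bias c) (probability (f true) c cs ms) (probability (f false) c cs ms)
  probability (tossStored i f) c cs ms =
    mix (bias (lookup ms i)) (probability (f true) c cs ms) (probability (f false) c cs ms)
  probability (random k f) c cs ms = h k * Σℚ (λ i → probability (f i) c cs ms)
  probability (store P) c cs ms = probability P c cs (c ∷ ms)
  probability (discard i P) c cs ms = probability P c cs (removeAt ms i)
  probability (next P) _ (c ∷ cs) ms = probability P c cs ms
  probability (output i) _ [] ms =
    if does (lookup ms i Fin.≟ target) then 1ℚ else 0ℚ

-- Real arithmetic acts termwise, so each entry of the success probability is the same polynomial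
-- evaluated at the corresponding entries of the biases, even where these are not probabilities.
seq-programProbability : ∀ {n} (bias : Fin n → ℝ) target j {r m} (P : Program r m) c cs ms →
  seq (programProbability bias target P c cs ms) j ≡ probability (λ i → seq (bias i) j) target P c cs ms
seq-programProbability bias target j (tossArriving f) c cs ms =
  cong₂ (mix (seq (bias c) j)) (seq-programProbability bias target j (f true) c cs ms)
                               (seq-programProbability bias target j (f false) c cs ms)
seq-programProbability bias target j (tossStored i f) c cs ms =
  cong₂ (mix (seq (bias (lookup ms i)) j)) (seq-programProbability bias target j (f true) c cs ms)
                                           (seq-programProbability bias target j (f false) c cs ms)
seq-programProbability bias target j (random k f) c cs ms = cong (h k *_)
  (trans (seq-Σ (λ i → programProbability bias target (f i) c cs ms) j)
         (Σℚ-cong (λ i → seq-programProbability bias target j (f i) c cs ms)))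
seq-programProbability bias target j (store P) c cs ms = seq-programProbability bias target j P c cs (c ∷ ms)
seq-programProbability bias target j (discard i P) c cs ms = seq-programProbability bias target j P c cs (removeAt ms i)
seq-programProbability bias target j (next P) _ (c ∷ cs) ms = seq-programProbability bias target j P c cs ms
seq-programProbability bias target j (output i) _ [] ms with does (lookup ms i Fin.≟ target)
... | true  = refl
... | false = refl

-- Follows the recursion of `mix-lipschitz`. Any finite value serves, so an average over random
-- choices is crudely bounded by a sum.
lipschitzConstant : ∀ {r m} → Program r m → ℚ
lipschitzConstant (tossArriving f) = 2ℚ * (lipschitzConstant (f true) + lipschitzConstant (f false)) + 1ℚ
lipschitzConstant (tossStored _ f) = 2ℚ * (lipschitzConstant (f true) + lipschitzConstant (f false)) + 1ℚ
lipschitzConstant (random _ f)     = Σℚ (λ i → lipschitzConstant (f i))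
lipschitzConstant (store P)        = lipschitzConstant P
lipschitzConstant (discard _ P)    = lipschitzConstant P
lipschitzConstant (next P)         = lipschitzConstant P
lipschitzConstant (output _)       = 0ℚ

0≤lipschitzConstant : ∀ {r m} (P : Program r m) → 0ℚ ≤ lipschitzConstant P
0≤lipschitzConstant (tossArriving f) =
  0≤+ (0≤* {2ℚ} (0≤+ 0≤1 0≤1) (0≤+ (0≤lipschitzConstant (f true)) (0≤lipschitzConstant (f false)))) 0≤1
0≤lipschitzConstant (tossStored _ f) =
  0≤+ (0≤* {2ℚ} (0≤+ 0≤1 0≤1) (0≤+ (0≤lipschitzConstant (f true)) (0≤lipschitzConstant (f false)))) 0≤1
0≤lipschitzConstant (random _ f)     = 0≤Σℚ (λ i → 0≤lipschitzConstant (f i))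
0≤lipschitzConstant (store P)        = 0≤lipschitzConstant P
0≤lipschitzConstant (discard _ P)    = 0≤lipschitzConstant P
0≤lipschitzConstant (next P)         = 0≤lipschitzConstant P
0≤lipschitzConstant (output _)       = ≤-refl

module _ {n : ℕ} {bias : Fin n → ℚ} {target : Fin n} (bias∈ : ∀ i → InUnit (bias i)) where

  probability∈ : ∀ {r m} (P : Program r m) c cs ms → InUnit (probability bias target P c cs ms)
  probability∈ (tossArriving f) c cs ms =
    let l₁ , u₁ = probability∈ (f true) c cs ms
        l₀ , u₀ = probability∈ (f false) c cs ms
    in ≤mix (bias∈ c) l₁ l₀ , mix≤ (bias∈ c) u₁ u₀
  probability∈ (tossStored i f) c cs ms =
    let l₁ , u₁ = probability∈ (f true) c cs ms
        l₀ , u₀ = probability∈ (f false) c cs ms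
    in ≤mix (bias∈ (lookup ms i)) l₁ l₀ , mix≤ (bias∈ (lookup ms i)) u₁ u₀
  probability∈ (random k f) c cs ms =
    0≤* (0≤h k) (0≤Σℚ (λ i → proj₁ (probability∈ (f i) c cs ms))) ,
    subst (h k * Σℚ (λ i → probability bias target (f i) c cs ms) ≤_) (h*ι k)
      (*-monoˡ (h k) (0≤h k) (Σℚ≤ι (λ i → proj₂ (probability∈ (f i) c cs ms))))
  probability∈ (store P) c cs ms = probability∈ P c cs (c ∷ ms)
  probability∈ (discard i P) c cs ms = probability∈ P c cs (removeAt ms i)
  probability∈ (next P) _ (c ∷ cs) ms = probability∈ P c cs ms
  probability∈ (output i) _ [] ms with does (lookup ms i Fin.≟ target)
  ... | true  = 0≤1 , ≤-refl
  ... | false = ≤-refl , 0≤1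

  -- Only the choice `i` is credited; all others count as failures.
  probability-random : ∀ {r m k} {f : Fin (suc k) → Program r m} {c cs ms v} i →
    v ≤ probability bias target (f i) c cs ms → h k * v ≤ probability bias target (random k f) c cs ms
  probability-random {k = k} {f} {c} {cs} {ms} i v≤ = *-monoˡ (h k) (0≤h k)
    (≤-trans v≤ (≤Σℚ (λ i → proj₁ (probability∈ (f i) c cs ms)) i))

  module _ {bias′ : Fin n → ℚ} {η : ℚ} (0≤η : 0ℚ ≤ η) (η≤1 : η ≤ 1ℚ)
           (close : ∀ i → ∣ bias′ i - bias i ∣ ≤ η) where

    probability-lipschitz : ∀ {r m} (P : Program r m) c cs ms →
      ∣ probability bias′ target P c cs ms - probability bias target P c cs ms ∣ ≤ lipschitzConstant P * η
    probability-lipschitz (tossArriving f) c cs ms =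
      mix-lipschitz {p = bias′ c} {x = probability bias′ target (f true) c cs ms}
        {y = probability bias′ target (f false) c cs ms}
        {k = lipschitzConstant (f true)} {l = lipschitzConstant (f false)}
        (bias∈ c) (probability∈ (f true) c cs ms) (probability∈ (f false) c cs ms) η≤1 (close c)
        (probability-lipschitz (f true) c cs ms) (probability-lipschitz (f false) c cs ms)
    probability-lipschitz (tossStored i f) c cs ms =
      mix-lipschitz {p = bias′ (lookup ms i)} {x = probability bias′ target (f true) c cs ms}
        {y = probability bias′ target (f false) c cs ms}
        {k = lipschitzConstant (f true)} {l = lipschitzConstant (f false)}
        (bias∈ (lookup ms i)) (probability∈ (f true) c cs ms) (probability∈ (f false) c cs ms) η≤1
        (close (lookup ms i))
        (probability-lipschitz (f true) c cs ms) (probability-lipschitz (f false) c cs ms)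
    probability-lipschitz (random k f) c cs ms = begin
      ∣ h k * X - h k * Y ∣      ≡⟨ cong ∣_∣ (solve 3 (λ h x y → h :* x :- h :* y := h :* (x :- y)) refl (h k) X Y) ⟩
      ∣ h k * (X - Y) ∣          ≡⟨ ∣p*q∣≡∣p∣*∣q∣ (h k) (X - Y) ⟩
      ∣ h k ∣ * ∣ X - Y ∣        ≤⟨ *-monoʳ ∣ X - Y ∣ (0≤∣p∣ (X - Y)) (∣p∣≤1 (0≤h k , h≤1 k)) ⟩
      1ℚ * ∣ X - Y ∣             ≡⟨ *-identityˡ ∣ X - Y ∣ ⟩
      ∣ X - Y ∣                  ≤⟨ ∣Σℚ-Σℚ∣≤ {v = λ i → probability bias′ target (f i) c cs ms}
                                      {w = λ i → probability bias target (f i) c cs ms}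
                                      {l = λ i → lipschitzConstant (f i)} (λ i → probability-lipschitz (f i) c cs ms) ⟩
      Σℚ (λ i → lipschitzConstant (f i)) * η ∎
      where
      open ≤-Reasoning
      X Y : ℚ
      X = Σℚ (λ i → probability bias′ target (f i) c cs ms)
      Y = Σℚ (λ i → probability bias target (f i) c cs ms)
    probability-lipschitz (store P) c cs ms = probability-lipschitz P c cs (c ∷ ms)
    probability-lipschitz (discard i P) c cs ms = probability-lipschitz P c cs (removeAt ms i)
    probability-lipschitz (next P) _ (c ∷ cs) ms = probability-lipschitz P c cs ms
    probability-lipschitz (output i) _ [] ms = ≤-reflexive
      (trans (cong ∣_∣ (+-inverseʳ o)) (sym (*-zeroˡ η)))
      where
      o : ℚ
      o = if does (lookup ms i Fin.≟ target) then 1ℚ else 0ℚ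

-- A match between two coins

count : Bool → ℕ → ℕ
count true  = suc
count false = λ a → a

-- The two topmost stored coins have shown a and b heads; s rounds are left.
duel : ∀ {r m} → ℕ → ℕ → ℕ → Program r (suc m) → Program r (suc (suc m))
duel zero a b P with a ℕ.≤? b
... | yes _ = discard zero P
... | no  _ = discard (suc zero) P
duel (suc s) a b P = tossStored zero λ x → tossStored (suc zero) λ y → duel s (count x a) (count y b) P

module _ {n : ℕ} {bias : Fin n → ℚ} {target : Fin n} (bias∈ : ∀ i → InUnit (bias i))
         {r m : ℕ} {P : Program r (suc m)} {c : Fin n} {cs : Vec (Fin n) r} {ms : Vec (Fin n) m} where

  private
    success : Fin n → ℚ
    success z = probability bias target P c cs (z ∷ ms)

    duelSuccess : ℕ → ℕ → ℕ → Fin n → Fin n → ℚ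
    duelSuccess s a b y z = probability bias target (duel s a b P) c cs (y ∷ z ∷ ms)

  -- For matches whose outcome does not matter: the bound is available whichever coin survives.
  ≤duel : ∀ {v y z} → v ≤ success y → v ≤ success z → ∀ s a b → v ≤ duelSuccess s a b y z
  ≤duel v≤y v≤z zero a b with a ℕ.≤? b
  ... | yes _ = v≤z
  ... | no  _ = v≤y
  ≤duel {y = y} {z} v≤y v≤z (suc s) a b = ≤mix (bias∈ y)
    (≤mix (bias∈ z) (≤duel v≤y v≤z s (suc a) (suc b)) (≤duel v≤y v≤z s (suc a) b))
    (≤mix (bias∈ z) (≤duel v≤y v≤z s a (suc b)) (≤duel v≤y v≤z s a b))

  -- E [ grow ^ (heads of z) * shrink ^ (heads of y) ] bounds the probability that z shows at
  -- least as many heads as y, because 1 ≤ grow and 1 ≤ grow * shrink; a round multiplies it by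
  -- (1 - p + p * shrink) * (1 - q + q * grow) ≤ 1 - t ^ 2, where p and q are the biases of y and z.
  module _ {t : ℚ} (0≤t : 0ℚ ≤ t) (t≤1 : t ≤ 1ℚ) where

    grow shrink : ℚ
    grow   = 1ℚ + t
    shrink = (1ℚ - t) + t * t

    1≤grow : 1ℚ ≤ grow
    1≤grow = by-slack t 0≤t refl

    0≤grow : 0ℚ ≤ grow
    0≤grow = ≤-trans 0≤1 1≤grow

    0≤shrink : 0ℚ ≤ shrink
    0≤shrink = 0≤+ (p≤q⇒0≤q-p t≤1) (0≤* 0≤t 0≤t)

    -- `shrink` is a polynomial substitute for 1 / (1 + t): a pair of heads contributes
    -- `grow * shrink` = 1 + t ^ 3, and each surplus head of the second coin contributes `grow`.
    1≤shrink^*grow^ : ∀ {a b} → a ℕ.≤ b → 1ℚ ≤ shrink ^ a * grow ^ b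
    1≤shrink^*grow^ {b = b} ℕ.z≤n = ≤-trans (1≤^ b) (≤-reflexive (sym (*-identityˡ (grow ^ b))))
      where
      1≤^ : ∀ b → 1ℚ ≤ grow ^ b
      1≤^ zero    = ≤-refl
      1≤^ (suc b) = ≤-trans 1≤grow (≤-trans (≤-reflexive (sym (*-identityʳ grow))) (*-monoˡ grow 0≤grow (1≤^ b)))
    1≤shrink^*grow^ {suc a} {suc b} (ℕ.s≤s a≤b) = ≤-trans (1≤shrink^*grow^ a≤b)
      (by-slack (t * (t * t) * (A * B)) (0≤* (0≤* 0≤t (0≤* 0≤t 0≤t)) (0≤* (0≤^ a 0≤shrink) (0≤^ b 0≤grow)))
        (solve 3 (λ t A B → A :* B :+ t :* (t :* t) :* (A :* B) := (((con 1ℚ :- t) :+ t :* t) :* A) :* ((con 1ℚ :+ t) :* B)) refl t A B))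
      where
      A B : ℚ
      A = shrink ^ a
      B = grow ^ b

    private
      potential : ℕ → ℕ → ℕ → ℚ
      potential s a b = (1ℚ - t * t) ^ s * (shrink ^ a * grow ^ b)

      t²≤1 : t * t ≤ 1ℚ
      t²≤1 = ≤-trans (*-monoˡ t 0≤t t≤1) (≤-trans (≤-reflexive (*-identityʳ t)) t≤1)

      0≤potential : ∀ s a b → 0ℚ ≤ potential s a b
      0≤potential s a b = 0≤* (0≤^ s (p≤q⇒0≤q-p t²≤1)) (0≤* (0≤^ a 0≤shrink) (0≤^ b 0≤grow))

      expectedPotential : ∀ {p q} → InUnit p → InUnit q → q + (t + t) ≤ p → ∀ s a b →
        mix p (mix q (potential s (suc a) (suc b)) (potential s (suc a) b))
              (mix q (potential s a (suc b)) (potential s a b)) ≤ potential (suc s) a b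
      expectedPotential {p} {q} (0≤p , p≤1) (0≤q , q≤1) gap s a b = by-slack
        -- Apart from S A B, this is (1 - t ^ 2) - (1 - p t + p t ^ 2) (1 + q t), arranged as three
        -- nonnegative terms; the gap makes the first one so.
        (S * (A * B) * (t * (p - (q + (t + t))) + ((1ℚ - p) * (t * t) + p * q * (t * t) * (1ℚ - t))))
        (0≤* (0≤* (0≤^ s (p≤q⇒0≤q-p t²≤1)) (0≤* (0≤^ a 0≤shrink) (0≤^ b 0≤grow)))
          (0≤+ (0≤* 0≤t (p≤q⇒0≤q-p gap))
            (0≤+ (0≤* (p≤q⇒0≤q-p p≤1) (0≤* 0≤t 0≤t))
                 (0≤* (0≤* (0≤* 0≤p 0≤q) (0≤* 0≤t 0≤t)) (p≤q⇒0≤q-p t≤1)))))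
        (solve 6 (λ p q t S A B →
          let one = con 1ℚ
              u = one :+ t
              d = (one :- t) :+ t :* t
              mx = λ p x y → p :* x :+ (one :- p) :* y
          in mx p (mx q (S :* ((d :* A) :* (u :* B))) (S :* ((d :* A) :* B)))
                  (mx q (S :* (A :* (u :* B))) (S :* (A :* B)))
             :+ S :* (A :* B) :* (t :* (p :- (q :+ (t :+ t))) :+ ((one :- p) :* (t :* t) :+ p :* q :* (t :* t) :* (one :- t)))
             := ((one :- t :* t) :* S) :* (A :* B)) refl p q t S A B)
        where
        S A B : ℚ
        S = (1ℚ - t * t) ^ s
        A = shrink ^ a
        B = grow ^ b

      mix-- : ∀ p q v w x y z → mix p (mix q (v - w) (v - x)) (mix q (v - y) (v - z)) ≡ v - mix p (mix q w x) (mix q y z)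
      mix-- = solve 7 (λ p q v w x y z →
        let mx = λ p x y → p :* x :+ (con 1ℚ :- p) :* y
        in mx p (mx q (v :- w) (v :- x)) (mx q (v :- y) (v :- z)) := v :- mx p (mx q w x) (mx q y z)) refl

      -- Two independent tosses may be exchanged: a round tosses `y` before `z`, while
      -- `expectedPotential` has the better coin outermost.
      mix-swap : ∀ p q w x y z → mix q (mix p w x) (mix p y z) ≡ mix p (mix q w y) (mix q x z)
      mix-swap = solve 6 (λ p q w x y z →
        let mx = λ p x y → p :* x :+ (con 1ℚ :- p) :* y
        in mx q (mx p w x) (mx p y z) := mx p (mx q w y) (mx q x z)) refl

      v-≤v : ∀ {v w e} → v ≤ w → 0ℚ ≤ e → v - e ≤ w
      v-≤v {v} {w} {e} v≤w 0≤e = ≤-trans (by-slack e 0≤e (solve 2 (λ v e → (v :- e) :+ e := v) refl v e)) v≤w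

      v-1≤ : ∀ {v w e} → v ≤ 1ℚ → 0ℚ ≤ w → 1ℚ ≤ e → v - e ≤ w
      v-1≤ {v} {w} {e} v≤1 0≤w 1≤e = ≤-trans (q-p≥0⇒p≤q (subst (0ℚ ≤_)
        (solve 2 (λ v e → (con 1ℚ :- v) :+ (e :- con 1ℚ) := con 0ℚ :- (v :- e)) refl v e)
        (0≤+ (p≤q⇒0≤q-p v≤1) (p≤q⇒0≤q-p 1≤e)))) 0≤w

    -- `v - potential` bounds the success probability from any score. If the match is lost, the
    -- potential is at least 1 ≥ v and the bound is trivial; if it is won, `v` is available in full;
    -- and a round does not raise the expected potential.
    duel-first : ∀ {v y z} → v ≤ 1ℚ → v ≤ success y → bias z + (t + t) ≤ bias y →
                 ∀ s a b → v - potential s a b ≤ duelSuccess s a b y z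
    duel-first {z = z} v≤1 v≤y gap zero a b with a ℕ.≤? b
    ... | yes a≤b = v-1≤ v≤1 (proj₁ (probability∈ bias∈ P c cs (z ∷ ms)))
                      (≤-trans (1≤shrink^*grow^ a≤b) (≤-reflexive (sym (*-identityˡ _))))
    ... | no  _   = v-≤v v≤y (0≤potential 0 a b)
    duel-first {v} {y} {z} v≤1 v≤y gap (suc s) a b = begin
      v - potential (suc s) a b
        ≤⟨ +-monoʳ-≤ v (neg-antimono-≤ (expectedPotential (bias∈ y) (bias∈ z) gap s a b)) ⟩
      v - mix (bias y) (mix (bias z) (potential s (suc a) (suc b)) (potential s (suc a) b))
                       (mix (bias z) (potential s a (suc b)) (potential s a b))
        ≡⟨ mix-- (bias y) (bias z) v _ _ _ _ ⟨
      mix (bias y) (mix (bias z) (v - potential s (suc a) (suc b)) (v - potential s (suc a) b))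
                   (mix (bias z) (v - potential s a (suc b)) (v - potential s a b))
        ≤⟨ mix-mono (bias∈ y)
             (mix-mono (bias∈ z) (duel-first v≤1 v≤y gap s (suc a) (suc b)) (duel-first v≤1 v≤y gap s (suc a) b))
             (mix-mono (bias∈ z) (duel-first v≤1 v≤y gap s a (suc b)) (duel-first v≤1 v≤y gap s a b)) ⟩
      duelSuccess (suc s) a b y z ∎
      where open ≤-Reasoning

    -- A tie keeps `z`, so `z` is lost only if b < a. The estimate for b ≤ a covers this, and one
    -- potential serves both sides.
    duel-second : ∀ {v y z} → v ≤ 1ℚ → v ≤ success z → bias y + (t + t) ≤ bias z →
                  ∀ s a b → v - potential s b a ≤ duelSuccess s a b y z
    duel-second {y = y} v≤1 v≤z gap zero a b with a ℕ.≤? b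
    ... | yes _   = v-≤v v≤z (0≤potential 0 b a)
    ... | no  a≰b = v-1≤ v≤1 (proj₁ (probability∈ bias∈ P c cs (y ∷ ms)))
                      (≤-trans (1≤shrink^*grow^ (ℕ.<⇒≤ (ℕ.≰⇒> a≰b))) (≤-reflexive (sym (*-identityˡ _))))
    duel-second {v} {y} {z} v≤1 v≤z gap (suc s) a b = begin
      v - potential (suc s) b a
        ≤⟨ +-monoʳ-≤ v (neg-antimono-≤ (expectedPotential (bias∈ z) (bias∈ y) gap s b a)) ⟩
      v - mix (bias z) (mix (bias y) (potential s (suc b) (suc a)) (potential s (suc b) a))
                       (mix (bias y) (potential s b (suc a)) (potential s b a))
        ≡⟨ cong (_-_ v) (mix-swap (bias y) (bias z) _ _ _ _) ⟩
      v - mix (bias y) (mix (bias z) (potential s (suc b) (suc a)) (potential s b (suc a)))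
                       (mix (bias z) (potential s (suc b) a) (potential s b a))
        ≡⟨ mix-- (bias y) (bias z) v _ _ _ _ ⟨
      mix (bias y) (mix (bias z) (v - potential s (suc b) (suc a)) (v - potential s b (suc a)))
                   (mix (bias z) (v - potential s (suc b) a) (v - potential s b a))
        ≤⟨ mix-mono (bias∈ y)
             (mix-mono (bias∈ z) (duel-second v≤1 v≤z gap s (suc a) (suc b)) (duel-second v≤1 v≤z gap s (suc a) b))
             (mix-mono (bias∈ z) (duel-second v≤1 v≤z gap s a (suc b)) (duel-second v≤1 v≤z gap s a b)) ⟩
      duelSuccess (suc s) a b y z ∎
      where open ≤-Reasoning

    module _ {best : Fin n} (gap : ∀ i → i ≢ best → bias i + (t + t) ≤ bias best) where

      duel-best : ∀ {v y z} → v ≤ 1ℚ → v ≤ success best → y ≡ best ⊎ z ≡ best →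
                  ∀ s → v - (1ℚ - t * t) ^ s ≤ duelSuccess s 0 0 y z
      duel-best {v} {y} {z} v≤1 v≤ best∈ s = subst (λ e → v - e ≤ duelSuccess s 0 0 y z)
        (trans (cong ((1ℚ - t * t) ^ s *_) (*-identityˡ 1ℚ)) (*-identityʳ _)) (go best∈)
        where
        go : y ≡ best ⊎ z ≡ best → v - potential s 0 0 ≤ duelSuccess s 0 0 y z
        go b∈ with y Fin.≟ best | z Fin.≟ best
        -- The statement allows both contestants to be the best coin; then either survivor will do.
        go b∈ | yes refl | yes refl = v-≤v (≤duel v≤ v≤ s 0 0) (0≤potential s 0 0)
        go b∈ | yes refl | no z≢    = duel-first v≤1 v≤ (gap z z≢) s 0 0
        go b∈ | no y≢ | yes refl    = duel-second v≤1 v≤ (gap y y≢) s 0 0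
        go (inj₁ y≡) | no y≢ | no _ = ⊥-elim (y≢ y≡)
        go (inj₂ z≡) | no _ | no z≢ = ⊥-elim (z≢ z≡)

-- Tournaments

duel-tosses : ∀ {r m} s a b (P : Program r (suc m)) → programTosses (duel s a b P) ℕ.≤ 2 ℕ.* s ℕ.+ programTosses P
duel-tosses zero a b P with a ℕ.≤? b
... | yes _ = ℕ.≤-refl
... | no  _ = ℕ.≤-refl
duel-tosses (suc s) a b P = subst (programTosses (duel (suc s) a b P) ℕ.≤_)
  (ℕ-solve 2 (λ s x → ℕ-con 2 :+ℕ (ℕ-con 2 :*ℕ s :+ℕ x) :=ℕ ℕ-con 2 :*ℕ (ℕ-con 1 :+ℕ s) :+ℕ x) refl s (programTosses P))
  (ℕ.s≤s (ℕ.⊔-lub (ℕ.s≤s (ℕ.⊔-lub (duel-tosses s (suc a) (suc b) P) (duel-tosses s (suc a) b P)))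
                   (ℕ.s≤s (ℕ.⊔-lub (duel-tosses s a (suc b) P) (duel-tosses s a b P)))))

duel-memory : ∀ {r m M} s a b (P : Program r (suc m)) → suc (suc m) ℕ.≤ M → programMemory P ℕ.≤ M →
              programMemory (duel s a b P) ℕ.≤ M
duel-memory zero a b P m≤ P≤ with a ℕ.≤? b
... | yes _ = ℕ.⊔-lub m≤ P≤
... | no  _ = ℕ.⊔-lub m≤ P≤
duel-memory (suc s) a b P m≤ P≤ =
  ℕ.⊔-lub (ℕ.⊔-lub (duel-memory s (suc a) (suc b) P m≤ P≤) (duel-memory s (suc a) b P m≤ P≤))
          (ℕ.⊔-lub (duel-memory s a (suc b) P m≤ P≤) (duel-memory s a b P m≤ P≤))

-- Unlike in a `Program r m`, no coin is arriving: all r coins to come are yet to be received.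
data Plan : ℕ → ℕ → Set where
  keep    : ∀ {r m} → Plan r (suc m) → Plan (suc r) m
  skip    : ∀ {r m} → Plan r m → Plan (suc r) m
  compete : ∀ {r m} → ℕ → Plan r (suc m) → Plan r (suc (suc m))
  done    : ∀ {m} → Plan zero (suc m)

compile : ∀ {r m} → Plan r m → Program r m
compile (keep P)      = next (store (compile P))
compile (skip P)      = next (compile P)
compile (compete s P) = duel s 0 0 (compile P)
compile done          = output zero

-- An algorithm starts with its first coin already arriving, so the first `next` is dropped. With
-- empty memory a plan cannot begin with a match.
compileFirst : ∀ {r} → Plan (suc r) 0 → Program r 0
compileFirst (keep P) = store (compile P)
compileFirst (skip P) = compile P

-- In a `Tree d`, all leaves have depth d, except that `up` marks a missing sibling.
data Tree : ℕ → Set where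
  leaf : Tree 0
  up   : ∀ {d} → Tree d → Tree (suc d)
  node : ∀ {d} → Tree d → Tree d → Tree (suc d)

size : ∀ {d} → Tree d → ℕ
size leaf       = 1
size (up t)     = size t
size (node t u) = size t ℕ.+ size u

-- `size t + r`, associated so that the coins are consumed leaf by leaf.
leaves+ : ∀ {d} → Tree d → ℕ → ℕ
leaves+ leaf       r = suc r
leaves+ (up t)     r = leaves+ t r
leaves+ (node t u) r = leaves+ t (leaves+ u r)

leaves+≡size+ : ∀ {d} (t : Tree d) r → leaves+ t r ≡ size t ℕ.+ r
leaves+≡size+ leaf       r = refl
leaves+≡size+ (up t)     r = leaves+≡size+ t r
leaves+≡size+ (node t u) r = begin
  leaves+ t (leaves+ u r)    ≡⟨ leaves+≡size+ t (leaves+ u r) ⟩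
  size t ℕ.+ leaves+ u r     ≡⟨ cong (size t ℕ.+_) (leaves+≡size+ u r) ⟩
  size t ℕ.+ (size u ℕ.+ r)  ≡⟨ ℕ.+-assoc (size t) (size u) r ⟨
  size t ℕ.+ size u ℕ.+ r    ∎
  where open ≡-Reasoning

afterLeaves : ∀ {A : Set} {d r} (t : Tree d) → Vec A (leaves+ t r) → Vec A r
afterLeaves leaf       xs = tail xs
afterLeaves (up t)     xs = afterLeaves t xs
afterLeaves (node t u) xs = afterLeaves u (afterLeaves t xs)

Occurs : ∀ {A : Set} {d r} → A → (t : Tree d) → Vec A (leaves+ t r) → Set
Occurs a leaf       xs = head xs ≡ a
Occurs a (up t)     xs = Occurs a t xs
Occurs a (node t u) xs = Occurs a t xs ⊎ Occurs a u (afterLeaves t xs)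

lookup-afterLeaves : ∀ {A : Set} {d r} (t : Tree d) (xs : Vec A (leaves+ t r)) i → size t ℕ.≤ toℕ i →
  ∃[ j ] (toℕ i ≡ size t ℕ.+ toℕ j × lookup xs i ≡ lookup (afterLeaves t xs) j)
lookup-afterLeaves leaf       (x ∷ xs) (suc i) _ = i , refl , refl
lookup-afterLeaves (up t)     xs i t≤i = lookup-afterLeaves t xs i t≤i
lookup-afterLeaves (node t u) xs i tu≤i with lookup-afterLeaves t xs i (ℕ.m+n≤o⇒m≤o (size t) tu≤i)
... | j , i≡t+j , xsᵢ≡ with lookup-afterLeaves u (afterLeaves t xs) j
                             (ℕ.+-cancelˡ-≤ (size t) _ _ (subst (size t ℕ.+ size u ℕ.≤_) i≡t+j tu≤i))
... | k , j≡u+k , ysⱼ≡ = k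
  , trans i≡t+j (trans (cong (size t ℕ.+_) j≡u+k) (sym (ℕ.+-assoc (size t) (size u) (toℕ k))))
  , trans xsᵢ≡ ysⱼ≡

lookup-occurs : ∀ {A : Set} {d r} (t : Tree d) (xs : Vec A (leaves+ t r)) i → toℕ i ℕ.< size t →
                Occurs (lookup xs i) t xs
lookup-occurs leaf       (x ∷ xs) zero _ = refl
lookup-occurs leaf       (x ∷ xs) (suc i) (ℕ.s≤s ())
lookup-occurs (up t)     xs i i<t = lookup-occurs t xs i i<t
lookup-occurs (node t u) xs i i<tu with toℕ i ℕ.<? size t
... | yes i<t = inj₁ (lookup-occurs t xs i i<t)
... | no  i≮t with lookup-afterLeaves t xs i (ℕ.≮⇒≥ i≮t)
... | j , i≡t+j , xsᵢ≡ = inj₂ (subst (λ a → Occurs a u (afterLeaves t xs)) (sym xsᵢ≡)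
  (lookup-occurs u (afterLeaves t xs) j (ℕ.+-cancelˡ-< (size t) _ _ (subst (ℕ._< size t ℕ.+ size u) i≡t+j i<tu))))

full : ∀ d → Tree d
full zero    = leaf
full (suc d) = node (full d) (full d)

size-full : ∀ d → size (full d) ≡ 2 ℕ.^ d
size-full zero    = refl
size-full (suc d) = cong₂ ℕ._+_ (size-full d) (trans (size-full d) (sym (ℕ.+-identityʳ (2 ℕ.^ d))))

-- Filled from the left; it has k leaves only if 0 < k ≤ 2 ^ d.
packed : ∀ d → ℕ → Tree d
packed zero    k = leaf
packed (suc d) k with k ℕ.≤? 2 ℕ.^ d
... | yes _ = up (packed d k)
... | no  _ = node (full d) (packed d (k ℕ.∸ 2 ℕ.^ d))

packed-remainder : ∀ d {k} → k ℕ.≤ 2 ℕ.^ suc d → k ℕ.∸ 2 ℕ.^ d ℕ.≤ 2 ℕ.^ d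
packed-remainder d {k} k≤ = ℕ.m≤n+o⇒m∸n≤o k (2 ℕ.^ d)
  (subst (λ x → k ℕ.≤ 2 ℕ.^ d ℕ.+ x) (ℕ.+-identityʳ (2 ℕ.^ d)) k≤)

size-packed : ∀ d {k} → 0 ℕ.< k → k ℕ.≤ 2 ℕ.^ d → size (packed d k) ≡ k
size-packed zero 0<k k≤1 = ℕ.≤-antisym 0<k k≤1
size-packed (suc d) {k} 0<k k≤ with k ℕ.≤? 2 ℕ.^ d
... | yes k≤2ᵈ = size-packed d 0<k k≤2ᵈ
... | no  k≰2ᵈ = trans (cong₂ ℕ._+_ (size-full d) (size-packed d (ℕ.m<n⇒0<n∸m (ℕ.≰⇒> k≰2ᵈ)) (packed-remainder d k≤)))
                       (ℕ.m+[n∸m]≡n (ℕ.<⇒≤ (ℕ.≰⇒> k≰2ᵈ)))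

-- Tosses, memory and error of a tournament on a given tree

module _ (rounds : ℕ → ℕ) where

  -- The rest of the plan is a continuation that finds the winner of the tree on top of the memory.
  -- At a node, the winner of `u` thus lies above that of `t`.
  tournament : ∀ {d r m} (t : Tree d) → Plan r (suc m) → Plan (leaves+ t r) m
  tournament leaf           P = keep P
  tournament (up t)         P = tournament t P
  tournament {suc d} (node t u) P = tournament t (tournament u (compete (rounds d) P))

  totalRounds : ∀ {d} → Tree d → ℕ
  totalRounds leaf               = 0
  totalRounds (up t)             = totalRounds t
  totalRounds {suc d} (node t u) = totalRounds t ℕ.+ totalRounds u ℕ.+ rounds d

  tournament-tosses : ∀ {d r m} (t : Tree d) (P : Plan r (suc m)) →
    programTosses (compile (tournament t P)) ℕ.≤ 2 ℕ.* totalRounds t ℕ.+ programTosses (compile P)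
  tournament-tosses leaf   P = ℕ.≤-refl
  tournament-tosses (up t) P = tournament-tosses t P
  tournament-tosses {suc d} (node t u) P = begin
    programTosses (compile (tournament t Q))                    ≤⟨ tournament-tosses t Q ⟩
    2 ℕ.* T ℕ.+ programTosses (compile Q)                       ≤⟨ ℕ.+-monoʳ-≤ (2 ℕ.* T) (tournament-tosses u (compete s P)) ⟩
    2 ℕ.* T ℕ.+ (2 ℕ.* U ℕ.+ programTosses (duel s 0 0 (compile P)))
      ≤⟨ ℕ.+-monoʳ-≤ (2 ℕ.* T) (ℕ.+-monoʳ-≤ (2 ℕ.* U) (duel-tosses s 0 0 (compile P))) ⟩
    2 ℕ.* T ℕ.+ (2 ℕ.* U ℕ.+ (2 ℕ.* s ℕ.+ programTosses (compile P)))
      ≡⟨ ℕ-solve 4 (λ T U s x → ℕ-con 2 :*ℕ T :+ℕ (ℕ-con 2 :*ℕ U :+ℕ (ℕ-con 2 :*ℕ s :+ℕ x)) :=ℕ ℕ-con 2 :*ℕ (T :+ℕ U :+ℕ s) :+ℕ x) refl T U s _ ⟩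
    2 ℕ.* (T ℕ.+ U ℕ.+ s) ℕ.+ programTosses (compile P) ∎
    where
    open ℕ.≤-Reasoning
    T U s : ℕ
    T = totalRounds t
    U = totalRounds u
    s = rounds d
    Q = tournament u (compete s P)

  -- While `u` is played, the winner of `t` occupies one more place, but `u` is one level lower:
  -- stored coins plus height never increase.
  tournament-memory : ∀ {d r m M} (t : Tree d) (P : Plan r (suc m)) → suc m ℕ.+ d ℕ.≤ M →
    programMemory (compile P) ℕ.≤ M → programMemory (compile (tournament t P)) ℕ.≤ M
  tournament-memory leaf P m≤ P≤ = P≤
  tournament-memory {suc d} {m = m} {M} (up t) P m≤ P≤ =
    tournament-memory t P (ℕ.≤-trans (ℕ.+-monoʳ-≤ (suc m) (ℕ.n≤1+n d)) m≤) P≤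
  tournament-memory {suc d} {m = m} {M} (node t u) P m≤ P≤ =
    tournament-memory t _ (ℕ.≤-trans (ℕ.+-monoʳ-≤ (suc m) (ℕ.n≤1+n d)) m≤)
      (tournament-memory u _ m+d≤
        (duel-memory (rounds d) 0 0 (compile P) (ℕ.m+n≤o⇒m≤o (suc (suc m)) m+d≤) P≤))
    where
    m+d≤ : suc (suc m) ℕ.+ d ℕ.≤ M
    m+d≤ = subst (ℕ._≤ M) (ℕ.+-suc (suc m) d) m≤

  module _ {n : ℕ} {bias : Fin n → ℚ} {target : Fin n} (bias∈ : ∀ i → InUnit (bias i)) where

    private
      success : ∀ {r m} → Plan r m → Fin n → Vec (Fin n) r → Vec (Fin n) m → ℚ
      success P = probability bias target (compile P)

    -- For the subtrees beside the path of the best coin: nothing is known about their winners, so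
    -- the continuation has to tolerate every winner.
    ≤tournament : ∀ {d r m v} (t : Tree d) (P : Plan r (suc m)) {c cs ms} →
      (∀ c z → v ≤ success P c (afterLeaves t cs) (z ∷ ms)) → v ≤ success (tournament t P) c cs ms
    ≤tournament leaf   P {cs = z ∷ cs} v≤ = v≤ z z
    ≤tournament (up t) P v≤ = ≤tournament t P v≤
    ≤tournament {suc d} (node t u) P v≤ = ≤tournament t _ λ c y → ≤tournament u _ λ c z →
      ≤duel bias∈ (v≤ c z) (v≤ c y) (rounds d) 0 0

    module _ {t : ℚ} (0≤t : 0ℚ ≤ t) (t≤1 : t ≤ 1ℚ) {best : Fin n}
             (gap : ∀ i → i ≢ best → bias i + (t + t) ≤ bias best)
             {e : ℚ} (halves : ∀ d → (1ℚ - t * t) ^ rounds d ≤ ½ * (e * ½ ^ d)) where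

      -- The match at level i costs at most e / 2 ^ (i + 1), and these costs for i < d add up to e -
      -- e / 2 ^ d. An `up` plays no match and leaves its share unspent.
      tournament-best : ∀ {d r m v} (T : Tree d) (P : Plan r (suc m)) {c cs ms} → v ≤ 1ℚ → 0ℚ ≤ e →
        Occurs best T cs → (∀ c → v ≤ success P c (afterLeaves T cs) (best ∷ ms)) →
        v - (e - e * ½ ^ d) ≤ success (tournament T P) c cs ms
      tournament-best {r = r} {m} {v} leaf P {c} {z ∷ cs} {ms} v≤1 0≤e refl v≤ =
        subst (_≤ success P z cs (z ∷ ms)) (solve 2 (λ v e → v := v :- (e :- e :* con 1ℚ)) refl v e) (v≤ z)
      tournament-best {suc d} {v = v} (up T) P v≤1 0≤e b∈T v≤ = ≤-trans
        (by-slack (½ * (e * ½ ^ d)) (0≤* 0≤½ (0≤* 0≤e (0≤^ d 0≤½)))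
          (solve 3 (λ v e x → (v :- (e :- e :* (con ½ :* x))) :+ con ½ :* (e :* x) := v :- (e :- e :* x)) refl v e (½ ^ d)))
        (tournament-best T P v≤1 0≤e b∈T v≤)
      tournament-best {suc d} {v = v} (node T U) P {c} {cs} {ms} v≤1 0≤e b∈ v≤ =
        subst (_≤ success (tournament (node T U) P) c cs ms)
          (solve 3 (λ v e x → (v :- con ½ :* (e :* x)) :- (e :- e :* x) := v :- (e :- e :* (con ½ :* x))) refl v e (½ ^ d))
          (winner b∈)
        where
        w : ℚ
        -- The match at the node comes last in time but is paid for first: `w` is the guarantee that
        -- remains for the subtree before it.
        w = v - ½ * (e * ½ ^ d)

        w≤1 : w ≤ 1ℚ
        w≤1 = ≤-trans (by-slack (½ * (e * ½ ^ d)) (0≤* 0≤½ (0≤* 0≤e (0≤^ d 0≤½)))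
          (solve 2 (λ v y → (v :- y) :+ y := v) refl v (½ * (e * ½ ^ d)))) v≤1

        final : ∀ {y z} → y ≡ best ⊎ z ≡ best → ∀ c →
                w ≤ success (compete (rounds d) P) c (afterLeaves U (afterLeaves T cs)) (y ∷ z ∷ ms)
        final b∈ c = ≤-trans (+-monoʳ-≤ v (neg-antimono-≤ (halves d)))
          (duel-best bias∈ 0≤t t≤1 gap v≤1 (v≤ c) b∈ (rounds d))

        winner : Occurs best T cs ⊎ Occurs best U (afterLeaves T cs) →
                 w - (e - e * ½ ^ d) ≤ success (tournament (node T U) P) c cs ms
        winner (inj₁ b∈T) = tournament-best T _ w≤1 0≤e b∈T λ c →
          ≤tournament U _ λ c z → final (inj₂ refl) c
        winner (inj₂ b∈U) = ≤tournament T _ λ c z →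
          tournament-best U _ w≤1 0≤e b∈U (final (inj₁ refl))

n≤2^[1+⌊log₂n⌋] : ∀ n → n ℕ.≤ 2 ℕ.^ suc ⌊log₂ n ⌋
n≤2^[1+⌊log₂n⌋] n = ℕ.≮⇒≥ λ 2^<n → ℕ.<-irrefl refl
  (subst (ℕ._≤ ⌊log₂ n ⌋) (⌊log₂[2^n]⌋≡n (suc ⌊log₂ n ⌋)) (⌊log₂⌋-mono-≤ (ℕ.<⇒≤ 2^<n)))

maximum≤ : ∀ {k M} {f : Vector ℕ k} → (∀ i → f i ℕ.≤ M) → maximum f ℕ.≤ M
maximum≤ {zero}  f≤ = ℕ.z≤n
maximum≤ {suc k} f≤ = ℕ.⊔-lub (f≤ zero) (maximum≤ (f≤ ∘ suc))

-- The total number of rounds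

module _ (J R : ℕ) where

  roundsAt : ℕ → ℕ
  roundsAt d = (d ℕ.+ J) ℕ.* R

  -- The exact solution of F (d + 1) = 2 F d + (d + J) R, with the negative term moved to the left.
  -- It propagates because (d + J) + (d + J + 2) = 2 (d + J + 1).
  totalRounds-full : ∀ d → totalRounds roundsAt (full d) ℕ.+ (suc (d ℕ.+ J) ℕ.* R) ≡ suc J ℕ.* R ℕ.* 2 ℕ.^ d
  totalRounds-full zero    = sym (ℕ.*-identityʳ (suc J ℕ.* R))
  totalRounds-full (suc d) = begin
    F ℕ.+ F ℕ.+ (d ℕ.+ J) ℕ.* R ℕ.+ (2 ℕ.+ (d ℕ.+ J)) ℕ.* R
      ≡⟨ ℕ-solve 3 (λ F D R → F :+ℕ F :+ℕ D :*ℕ R :+ℕ (ℕ-con 2 :+ℕ D) :*ℕ R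
           :=ℕ ℕ-con 2 :*ℕ (F :+ℕ (ℕ-con 1 :+ℕ D) :*ℕ R)) refl F (d ℕ.+ J) R ⟩
    2 ℕ.* (F ℕ.+ suc (d ℕ.+ J) ℕ.* R)   ≡⟨ cong (2 ℕ.*_) (totalRounds-full d) ⟩
    2 ℕ.* (suc J ℕ.* R ℕ.* 2 ℕ.^ d)     ≡⟨ ℕ-solve 2 (λ x y → ℕ-con 2 :*ℕ (x :*ℕ y) :=ℕ x :*ℕ (ℕ-con 2 :*ℕ y)) refl (suc J ℕ.* R) (2 ℕ.^ d) ⟩
    suc J ℕ.* R ℕ.* (2 ℕ.* 2 ℕ.^ d)     ∎
    where
    open ≡-Reasoning
    F : ℕ
    F = totalRounds roundsAt (full d)

  -- The summand `suc J * R` on the left makes the cost proportional to k - 1. At a node, the full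
  -- subtree stays below its share by (d + 1 + J) R, which pays for the (d + J) R rounds of the
  -- match.
  totalRounds-packed : ∀ d {k} → 0 ℕ.< k → k ℕ.≤ 2 ℕ.^ d →
    totalRounds roundsAt (packed d k) ℕ.+ suc J ℕ.* R ℕ.≤ suc J ℕ.* R ℕ.* k
  totalRounds-packed zero {k} 0<k k≤ = subst (ℕ._≤ suc J ℕ.* R ℕ.* k) (ℕ.*-identityʳ (suc J ℕ.* R))
    (ℕ.*-monoʳ-≤ (suc J ℕ.* R) 0<k)
  totalRounds-packed (suc d) {k} 0<k k≤ with k ℕ.≤? 2 ℕ.^ d
  ... | yes k≤2ᵈ = totalRounds-packed d 0<k k≤2ᵈ
  ... | no  k≰2ᵈ = begin
    F ℕ.+ T ℕ.+ roundsAt d ℕ.+ W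
      ≤⟨ ℕ.m≤m+n (F ℕ.+ T ℕ.+ roundsAt d ℕ.+ W) R ⟩
    F ℕ.+ T ℕ.+ (d ℕ.+ J) ℕ.* R ℕ.+ W ℕ.+ R
      ≡⟨ ℕ-solve 5 (λ F T D R W → F :+ℕ T :+ℕ D :*ℕ R :+ℕ W :+ℕ R
           :=ℕ (F :+ℕ (ℕ-con 1 :+ℕ D) :*ℕ R) :+ℕ (T :+ℕ W)) refl F T (d ℕ.+ J) R W ⟩
    (F ℕ.+ suc (d ℕ.+ J) ℕ.* R) ℕ.+ (T ℕ.+ W)
      ≤⟨ ℕ.+-mono-≤ (ℕ.≤-reflexive (totalRounds-full d))
           (totalRounds-packed d (ℕ.m<n⇒0<n∸m (ℕ.≰⇒> k≰2ᵈ)) (packed-remainder d k≤)) ⟩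
    W ℕ.* 2 ℕ.^ d ℕ.+ W ℕ.* (k ℕ.∸ 2 ℕ.^ d)
      ≡⟨ ℕ.*-distribˡ-+ W (2 ℕ.^ d) (k ℕ.∸ 2 ℕ.^ d) ⟨
    W ℕ.* (2 ℕ.^ d ℕ.+ (k ℕ.∸ 2 ℕ.^ d))
      ≡⟨ cong (W ℕ.*_) (ℕ.m+[n∸m]≡n (ℕ.<⇒≤ (ℕ.≰⇒> k≰2ᵈ))) ⟩
    W ℕ.* k ∎
    where
    open ℕ.≤-Reasoning
    F T W : ℕ
    F = totalRounds roundsAt (full d)
    T = totalRounds roundsAt (packed d (k ℕ.∸ 2 ℕ.^ d))
    W = suc J ℕ.* R

-- Tournaments on a window of the stream

skips : ∀ {r m} a → Plan r m → Plan (a ℕ.+ r) m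
skips zero    P = P
skips (suc a) P = skip (skips a P)

skipAll : ∀ r {m} → Plan r (suc m)
skipAll zero    = done
skipAll (suc r) = skip (skipAll r)

afterSkips : ∀ {A : Set} {r} a → Vec A (a ℕ.+ r) → Vec A r
afterSkips zero    xs       = xs
afterSkips (suc a) (x ∷ xs) = afterSkips a xs

lookup-afterSkips : ∀ {A : Set} {r} a (xs : Vec A (a ℕ.+ r)) i → a ℕ.≤ toℕ i →
  ∃[ j ] (toℕ i ≡ a ℕ.+ toℕ j × lookup xs i ≡ lookup (afterSkips a xs) j)
lookup-afterSkips zero    xs       i       _           = i , refl , refl
lookup-afterSkips (suc a) (x ∷ xs) (suc i) (ℕ.s≤s a≤i) =
  let j , i≡ , xsᵢ≡ = lookup-afterSkips a xs i a≤i in j , cong suc i≡ , xsᵢ≡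

skips-tosses : ∀ {r m} a (P : Plan r m) → programTosses (compile (skips a P)) ≡ programTosses (compile P)
skips-tosses zero    P = refl
skips-tosses (suc a) P = skips-tosses a P

skips-memory : ∀ {r m} a (P : Plan r m) → programMemory (compile (skips a P)) ≡ programMemory (compile P)
skips-memory zero    P = refl
skips-memory (suc a) P = skips-memory a P

skipAll-tosses : ∀ r {m} → programTosses (compile (skipAll r {m})) ≡ 0
skipAll-tosses zero    = refl
skipAll-tosses (suc r) = skipAll-tosses r

skipAll-memory : ∀ r {m} → programMemory (compile (skipAll r {m})) ≡ suc m
skipAll-memory zero    = refl
skipAll-memory (suc r) = skipAll-memory r

compileFirst-tosses : ∀ {r} (P : Plan (suc r) 0) → programTosses (compileFirst P) ≡ programTosses (compile P)
compileFirst-tosses (keep P) = refl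
compileFirst-tosses (skip P) = refl

compileFirst-memory : ∀ {r} (P : Plan (suc r) 0) → programMemory (compileFirst P) ≡ programMemory (compile P)
compileFirst-memory (keep P) = refl
compileFirst-memory (skip P) = refl

module _ {n : ℕ} {bias : Fin n → ℚ} {target : Fin n} where

  ≤skips : ∀ {r m v} a (P : Plan r m) {c cs ms} →
    (∀ c → v ≤ probability bias target (compile P) c (afterSkips a cs) ms) →
    v ≤ probability bias target (compile (skips a P)) c cs ms
  ≤skips zero    P {c}           v≤ = v≤ c
  ≤skips (suc a) P {cs = x ∷ cs} v≤ = ≤skips a P v≤

  probability-skipAll : ∀ r {m c cs} {ms : Vec (Fin n) m} →
    probability bias target (compile (skipAll r)) c cs (target ∷ ms) ≡ 1ℚ
  probability-skipAll zero {cs = []} with target Fin.≟ target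
  ... | yes _ = refl
  ... | no t≢t = ⊥-elim (t≢t refl)
  probability-skipAll (suc r) {cs = x ∷ cs} = probability-skipAll r

  probability-compileFirst : ∀ {r} (P : Plan (suc r) 0) {c cs} →
    probability bias target (compileFirst P) c cs [] ≡ probability bias target (compile P) c (c ∷ cs) []
  probability-compileFirst (keep P) = refl
  probability-compileFirst (skip P) = refl

module _ (rounds : ℕ → ℕ) {d : ℕ} (a : ℕ) (T : Tree d) (r : ℕ) where

  -- With `N` a variable, the facts about the transported plan follow by matching the equation
  -- against `refl`.
  window : ∀ {N} → a ℕ.+ leaves+ T r ≡ N → Plan N 0
  window a+T+r≡N = subst (λ N → Plan N 0) a+T+r≡N (skips a (tournament rounds T (skipAll r)))

  window-tosses : ∀ {N} (eq : a ℕ.+ leaves+ T r ≡ N) →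
    programTosses (compile (window eq)) ℕ.≤ 2 ℕ.* totalRounds rounds T
  window-tosses refl = begin
    programTosses (compile (skips a (tournament rounds T (skipAll r)))) ≡⟨ skips-tosses a _ ⟩
    programTosses (compile (tournament rounds T (skipAll r)))           ≤⟨ tournament-tosses rounds T (skipAll r) ⟩
    2 ℕ.* totalRounds rounds T ℕ.+ programTosses (compile (skipAll r))  ≡⟨ cong (2 ℕ.* totalRounds rounds T ℕ.+_) (skipAll-tosses r) ⟩
    2 ℕ.* totalRounds rounds T ℕ.+ 0                                    ≡⟨ ℕ.+-identityʳ _ ⟩
    2 ℕ.* totalRounds rounds T ∎
    where open ℕ.≤-Reasoning

  window-memory : ∀ {N} (eq : a ℕ.+ leaves+ T r ≡ N) → programMemory (compile (window eq)) ℕ.≤ suc d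
  window-memory refl = subst (ℕ._≤ suc d) (sym (skips-memory a _))
    (tournament-memory rounds T (skipAll r) ℕ.≤-refl (subst (ℕ._≤ suc d) (sym (skipAll-memory r)) (ℕ.s≤s ℕ.z≤n)))

  window-best : ∀ {n} {bias : Fin n → ℚ} → (∀ i → InUnit (bias i)) →
    ∀ {t} → 0ℚ ≤ t → t ≤ 1ℚ → ∀ {best} → (∀ i → i ≢ best → bias i + (t + t) ≤ bias best) →
    ∀ {e} → (∀ d → (1ℚ - t * t) ^ rounds d ≤ ½ * (e * ½ ^ d)) → 0ℚ ≤ e →
    ∀ {N} (eq : a ℕ.+ leaves+ T r ≡ N) {c} (cs : Vec (Fin n) N) i →
    a ℕ.≤ toℕ i → toℕ i ℕ.< a ℕ.+ size T → lookup cs i ≡ best →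
    1ℚ - e ≤ probability bias best (compile (window eq)) c cs []
  window-best bias∈ 0≤t t≤1 gap {e} halves 0≤e refl cs i a≤i i<a+T refl with lookup-afterSkips a cs i a≤i
  ... | j , i≡a+j , csᵢ≡ = ≤skips a _ λ c → ≤-trans
    (by-slack (e * ½ ^ d) (0≤* 0≤e (0≤^ d 0≤½))
      (solve 2 (λ e x → (con 1ℚ :- e) :+ e :* x := con 1ℚ :- (e :- e :* x)) refl e (½ ^ d)))
    (tournament-best rounds bias∈ 0≤t t≤1 gap halves T (skipAll r) ≤-refl 0≤e
      (subst (λ b → Occurs b T (afterSkips a cs)) (sym csᵢ≡) (lookup-occurs T (afterSkips a cs) j
        (ℕ.+-cancelˡ-< a _ _ (subst (ℕ._< a ℕ.+ size T) i≡a+j i<a+T))))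
      (λ c → ≤-reflexive (sym (probability-skipAll r))))

-- The choice of a random window

-- The stream of suc n coins is covered by suc m windows of equal width, one of which is
-- chosen at random; the last windows are shifted so as to end with the stream.
module _ (n m J R d : ℕ) (n<2^d : suc n ℕ.≤ 2 ℕ.^ d) where

  -- The quotient (n + 1) / (m + 1) rounded up, in a form that exhibits its predecessor, the factor
  -- in the toss bound.
  width : ℕ
  width = suc (n ℕ./ suc m)

  offset : ℕ → ℕ
  offset i = i ℕ.* width ℕ.⊓ (suc n ℕ.∸ width)

  private
    T : Tree d
    T = packed d width

    width≤n : width ℕ.≤ suc n
    width≤n = ℕ.s≤s (ℕ.m/n≤m n (suc m))

    size-T : size T ≡ width
    size-T = size-packed d (ℕ.s≤s ℕ.z≤n) (ℕ.≤-trans width≤n n<2^d)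

    rest : ℕ → ℕ
    rest i = suc n ℕ.∸ width ℕ.∸ offset i

    covers : ∀ i → offset i ℕ.+ leaves+ T (rest i) ≡ suc n
    covers i = begin
      offset i ℕ.+ leaves+ T (rest i)        ≡⟨ cong (offset i ℕ.+_) (leaves+≡size+ T (rest i)) ⟩
      offset i ℕ.+ (size T ℕ.+ rest i)       ≡⟨ cong (λ s → offset i ℕ.+ (s ℕ.+ rest i)) size-T ⟩
      offset i ℕ.+ (width ℕ.+ rest i)        ≡⟨ ℕ-solve 3 (λ a w r → a :+ℕ (w :+ℕ r) :=ℕ w :+ℕ (a :+ℕ r)) refl (offset i) width (rest i) ⟩
      width ℕ.+ (offset i ℕ.+ rest i)        ≡⟨ cong (width ℕ.+_) (ℕ.m+[n∸m]≡n (ℕ.m⊓n≤n (i ℕ.* width) (suc n ℕ.∸ width))) ⟩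
      width ℕ.+ (suc n ℕ.∸ width)            ≡⟨ ℕ.m+[n∸m]≡n width≤n ⟩
      suc n                                  ∎
      where open ≡-Reasoning

  windowPlan : ℕ → Plan (suc n) 0
  windowPlan i = window (roundsAt J R) (offset i) T (rest i) (covers i)

  windowProgram : Program n 0
  windowProgram = random m λ i → compileFirst (windowPlan (toℕ i))

  windowProgram-tosses : programTosses windowProgram ℕ.≤ 2 ℕ.* (suc J ℕ.* R ℕ.* (n ℕ./ suc m))
  windowProgram-tosses = maximum≤ {k = suc m} {f = λ i → programTosses (compileFirst (windowPlan (toℕ i)))} λ i → begin
    programTosses (compileFirst (windowPlan (toℕ i)))  ≡⟨ compileFirst-tosses (windowPlan (toℕ i)) ⟩
    programTosses (compile (windowPlan (toℕ i)))
      ≤⟨ window-tosses (roundsAt J R) (offset (toℕ i)) T (rest (toℕ i)) (covers (toℕ i)) ⟩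
    2 ℕ.* totalRounds (roundsAt J R) T                 ≤⟨ ℕ.*-monoʳ-≤ 2 (ℕ.+-cancelʳ-≤ W (totalRounds (roundsAt J R) T) (W ℕ.* (n ℕ./ suc m)) packed≤) ⟩
    2 ℕ.* (W ℕ.* (n ℕ./ suc m))                        ∎
    where
    open ℕ.≤-Reasoning
    W : ℕ
    W = suc J ℕ.* R
    -- The spare `W` pays for the `suc` in `width`, so windows of one coin cost no toss.
    packed≤ : totalRounds (roundsAt J R) T ℕ.+ W ℕ.≤ W ℕ.* (n ℕ./ suc m) ℕ.+ W
    packed≤ = ℕ.≤-trans (totalRounds-packed J R d (ℕ.s≤s ℕ.z≤n) (ℕ.≤-trans width≤n n<2^d))
      (ℕ.≤-reflexive (trans (ℕ.*-suc W (n ℕ./ suc m)) (ℕ.+-comm W _)))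

  windowProgram-memory : programMemory windowProgram ℕ.≤ suc d
  windowProgram-memory = maximum≤ {k = suc m} {f = λ i → programMemory (compileFirst (windowPlan (toℕ i)))} λ i → subst (ℕ._≤ suc d) (sym (compileFirst-memory (windowPlan (toℕ i))))
    (window-memory (roundsAt J R) (offset (toℕ i)) T (rest (toℕ i)) (covers (toℕ i)))

  private
    ∈window : ∀ {p} → p ℕ.< suc n →
              ∃[ i ] (i ℕ.< suc m × offset i ℕ.≤ p × p ℕ.< offset i ℕ.+ width)
    ∈window {p} p<n = i , ℕ.m<n*o⇒m/o<n p<m*w , ℕ.≤-trans (ℕ.m⊓n≤m (i ℕ.* width) _) (ℕ.m/n*n≤m p width) , upper
      where
      i : ℕ
      i = p ℕ./ width

      n<m*w : n ℕ.< suc m ℕ.* width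
      n<m*w = begin-strict
        n                                            ≡⟨ ℕ.m≡m%n+[m/n]*n n (suc m) ⟩
        n ℕ.% suc m ℕ.+ n ℕ./ suc m ℕ.* suc m        <⟨ ℕ.+-monoˡ-< _ (ℕ.m%n<n n (suc m)) ⟩
        suc m ℕ.+ n ℕ./ suc m ℕ.* suc m              ≡⟨ ℕ.*-comm (suc m) width ⟨
        suc m ℕ.* width                              ∎
        where open ℕ.≤-Reasoning

      p<m*w : p ℕ.< suc m ℕ.* width
      p<m*w = ℕ.<-≤-trans p<n n<m*w

      upper : p ℕ.< offset i ℕ.+ width
      upper with ℕ.≤-total (i ℕ.* width) (suc n ℕ.∸ width)
      ... | inj₁ ≤end = begin-strict
        p                                     ≡⟨ ℕ.m≡m%n+[m/n]*n p width ⟩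
        p ℕ.% width ℕ.+ i ℕ.* width           <⟨ ℕ.+-monoˡ-< (i ℕ.* width) (ℕ.m%n<n p width) ⟩
        width ℕ.+ i ℕ.* width                 ≡⟨ ℕ.+-comm width (i ℕ.* width) ⟩
        i ℕ.* width ℕ.+ width                 ≡⟨ cong (ℕ._+ width) (ℕ.m≤n⇒m⊓n≡m ≤end) ⟨
        offset i ℕ.+ width                    ∎
        where open ℕ.≤-Reasoning
      ... | inj₂ end≤ = begin-strict
        p                                     <⟨ p<n ⟩
        suc n                                 ≡⟨ ℕ.m∸n+n≡m width≤n ⟨
        (suc n ℕ.∸ width) ℕ.+ width           ≡⟨ cong (ℕ._+ width) (ℕ.m≥n⇒m⊓n≡n end≤) ⟨
        offset i ℕ.+ width                    ∎
        where open ℕ.≤-Reasoning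

  module _ {N : ℕ} {bias : Fin N → ℚ} (bias∈ : ∀ i → InUnit (bias i))
           {t : ℚ} (0≤t : 0ℚ ≤ t) (t≤1 : t ≤ 1ℚ) (halved : (1ℚ - t * t) ^ R ≤ ½)
           {best : Fin N} (gap : ∀ i → i ≢ best → bias i + (t + t) ≤ bias best) where

    private
      rounds-error : ∀ d → (1ℚ - t * t) ^ roundsAt J R d ≤ ½ * (2ℚ * ½ ^ J * ½ ^ d)
      rounds-error d = begin
        (1ℚ - t * t) ^ roundsAt J R d    ≤⟨ ^-*-≤ R (d ℕ.+ J) (p≤q⇒0≤q-p t²≤1) halved ⟩
        ½ ^ (d ℕ.+ J)                    ≡⟨ ^-+ ½ d J ⟩
        ½ ^ d * ½ ^ J                    ≡⟨ solve 2 (λ x y → x :* y := con ½ :* (con 2ℚ :* y :* x)) refl (½ ^ d) (½ ^ J) ⟩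
        ½ * (2ℚ * ½ ^ J * ½ ^ d)         ∎
        where
        open ≤-Reasoning
        t²≤1 : t * t ≤ 1ℚ
        t²≤1 = ≤-trans (*-monoˡ t 0≤t t≤1) (≤-trans (≤-reflexive (*-identityʳ t)) t≤1)

    windowProgram-best : ∀ c cs p → lookup (c ∷ cs) p ≡ best →
      h m * (1ℚ - 2ℚ * ½ ^ J) ≤ probability bias best windowProgram c cs []
    windowProgram-best c cs p p≡best with ∈window (Fin.toℕ<n p)
    ... | i , i<m , a≤p , p<a+w = probability-random bias∈
      {f = λ i → compileFirst (windowPlan (toℕ i))} (fromℕ< i<m)
      (subst (λ i → 1ℚ - 2ℚ * ½ ^ J ≤ probability bias best (compileFirst (windowPlan i)) c cs [])
        (sym (Fin.toℕ-fromℕ< i<m))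
        (subst (1ℚ - 2ℚ * ½ ^ J ≤_) (sym (probability-compileFirst (windowPlan i)))
          (window-best (roundsAt J R) (offset i) T (rest i) bias∈ 0≤t t≤1 gap rounds-error
            (0≤* {2ℚ} (0≤+ 0≤1 0≤1) (0≤^ J 0≤½)) (covers i) (c ∷ cs) p a≤p
            (subst (λ s → toℕ p ℕ.< offset i ℕ.+ s) (sym size-T) p<a+w) p≡best)))

-- The choice of the parameters

private
  0≤2 : 0ℚ ≤ 2ℚ
  0≤2 = 0≤+ 0≤1 0≤1

enclosure : ∀ x {g} → 0ℚ < g →
  ∃[ q ] ∃[ N ] (∀ k → N ℕ.≤ k → q + g ≤ seq x k × seq x k ≤ q + (g + (g + g)))
enclosure x {g} 0<g with cauchy x g 0<g
... | N , close = seq x N - (g + g) , N , λ k N≤k →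
      let ∣d∣≤g = close k N N≤k ℕ.≤-refl
          d≤g   = ≤-trans (p≤∣p∣ (seq x k - seq x N)) ∣d∣≤g
          d′≤g  = ≤-trans (p≤∣p∣ (seq x N - seq x k)) (subst (_≤ g) (∣-∣-sym (seq x k) (seq x N)) ∣d∣≤g)
      in by-slack _ (p≤q⇒0≤q-p d′≤g)
           (solve 3 (λ a b g → (b :- (g :+ g) :+ g) :+ (g :- (b :- a)) := a) refl (seq x k) (seq x N) g)
       , by-slack _ (p≤q⇒0≤q-p d≤g)
           (solve 3 (λ a b g → a :+ (g :- (a :- b)) := (b :- (g :+ g)) :+ (g :+ (g :+ g))) refl (seq x k) (seq x N) g)

-- The margin of two γ is a reserve: it is spent when the biases are moved to rational ones that
-- still have gap `q`.
positive-approximation : ∀ x → 0ᴿ <ᴿ x → ∃[ q ] ∃[ γ ] (0ℚ < q × 0ℚ < γ × ∃[ N ] (∀ k → N ℕ.≤ k →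
  q + (γ + γ) ≤ seq x k × seq x k ≤ q + q))
positive-approximation x (e , 0<e , K , e≤x) =
  let q , N , encl = enclosure x 0<g
      3g≤q = slack q (proj₂ (encl (K ℕ.⊔ N) (ℕ.m≤n⊔m K N))) (e≤x (K ℕ.⊔ N) (ℕ.m≤m⊔n K N))
  in q , ½ * g , <-≤-trans 0<g (≤-trans (by-slack (g + g) (0≤+ 0≤g 0≤g) refl) 3g≤q) , 0<* 0<½ 0<g , N ,
     λ k N≤k → subst (λ z → q + z ≤ seq x k) (sym (half g)) (proj₁ (encl k N≤k)) ,
               ≤-trans (proj₂ (encl k N≤k)) (+-monoʳ-≤ q 3g≤q)
  where
  g : ℚ
  -- As x ≥ e = 8 g, the lower end `q` is at least 5 g, so the length 3 g of the enclosure fits into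
  -- a second `q`.
  g = ⅛ * e
  0<g : 0ℚ < g
  0<g = 0<* (from-yes (0ℚ <? ⅛)) 0<e
  0≤g : 0ℚ ≤ g
  0≤g = <⇒≤ 0<g
  slack : ∀ q {s} → s ≤ q + (g + (g + g)) → 0ℚ + e ≤ s → g + (g + g) ≤ q
  slack q {s} s≤ e≤s = q-p≥0⇒p≤q (subst (0ℚ ≤_)
    (solve 3 (λ q e s → (q :+ (con ⅛ :* e :+ (con ⅛ :* e :+ con ⅛ :* e)) :- s) :+ ((s :- (con 0ℚ :+ e)) :+ (con ⅛ :* e :+ con ⅛ :* e))
       := q :- (con ⅛ :* e :+ (con ⅛ :* e :+ con ⅛ :* e))) refl q e s)
    (0≤+ (p≤q⇒0≤q-p s≤) (0≤+ (p≤q⇒0≤q-p e≤s) (0≤+ 0≤g 0≤g))))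

0<⊓ : ∀ {p q} → 0ℚ < p → 0ℚ < q → 0ℚ < p ⊓ q
0<⊓ {p} {q} 0<p 0<q with ⊓-sel p q
... | inj₁ p⊓q≡p = subst (0ℚ <_) (sym p⊓q≡p) 0<p
... | inj₂ p⊓q≡q = subst (0ℚ <_) (sym p⊓q≡q) 0<q

-- A factor of two at both ends of the unit interval, because log (1 / x) has to be matched both for
-- x → 0 and for x → 1. The bound `below` lets success 1 - q imply success 1 - x.
record Approximates (q x : ℚ) : Set where
  field
    below      : q ≤ x
    above      : x ≤ q + q
    complement : 1ℚ - q ≤ (1ℚ - x) + (1ℚ - x)
    x≤1        : x ≤ 1ℚ

unit-approximation : ∀ x → 0ᴿ <ᴿ x → x <ᴿ 1ᴿ → ∃[ q ] (0ℚ < q × q < 1ℚ × ∃[ N ] (∀ k → N ℕ.≤ k → Approximates q (seq x k)))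
unit-approximation x (e , 0<e , K , e≤x) (e′ , 0<e′ , L , x≤1) =
  let q , N , encl     = enclosure x 0<g
      g≤q , q<1 , _ = approximates q N encl _ ℕ.≤-refl
  in q , <-≤-trans 0<g g≤q , q<1 , (K ℕ.⊔ L) ℕ.⊔ N , λ k k≥ → proj₂ (proj₂ (approximates q N encl k k≥))
  where
  f g : ℚ
  f = e ⊓ e′
  g = ⅛ * f
  0<f : 0ℚ < f
  0<f = 0<⊓ 0<e 0<e′
  0<g : 0ℚ < g
  0<g = 0<* (from-yes (0ℚ <? ⅛)) 0<f
  0≤g : 0ℚ ≤ g
  0≤g = <⇒≤ 0<g
  module _ (q : ℚ) (N : ℕ) (encl : ∀ k → N ℕ.≤ k → q + g ≤ seq x k × seq x k ≤ q + (g + (g + g))) where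
    approximates : ∀ k → (K ℕ.⊔ L) ℕ.⊔ N ℕ.≤ k → (g ≤ q) × (q < 1ℚ) × Approximates q (seq x k)
    approximates k k≥ = ≤-trans (by-slack (g + g) (0≤+ 0≤g 0≤g) refl) 3g≤q
      , <-≤-trans (subst (_< q + g) (+-identityʳ q) (+-monoʳ-< q 0<g)) (≤-trans l s≤1)
      , record
        { below      = ≤-trans (by-slack g 0≤g refl) l
        ; above      = ≤-trans u (+-monoʳ-≤ q 3g≤q)
        ; complement = q-p≥0⇒p≤q (subst (0ℚ ≤_)
            (solve 3 (λ q f s → (q :+ (con ⅛ :* f :+ (con ⅛ :* f :+ con ⅛ :* f)) :- s) :+ ((con 1ℚ :- (s :+ f)) :+ (con ½ :* f :+ con ⅛ :* f))
               := ((con 1ℚ :- s) :+ (con 1ℚ :- s)) :- (con 1ℚ :- q)) refl q f s)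
            (0≤+ (p≤q⇒0≤q-p u) (0≤+ (p≤q⇒0≤q-p s+f≤1) (0≤+ (0≤* 0≤½ (<⇒≤ 0<f)) 0≤g))))
        ; x≤1        = s≤1
        }
      where
      s : ℚ
      s = seq x k
      l : q + g ≤ s
      l = proj₁ (encl k (ℕ.m⊔n≤o⇒n≤o (K ℕ.⊔ L) N k≥))
      u : s ≤ q + (g + (g + g))
      u = proj₂ (encl k (ℕ.m⊔n≤o⇒n≤o (K ℕ.⊔ L) N k≥))
      s+f≤1 : s + f ≤ 1ℚ
      s+f≤1 = ≤-trans (+-monoʳ-≤ s (p⊓q≤q e e′)) (x≤1 k (ℕ.m⊔n≤o⇒n≤o K L (ℕ.m⊔n≤o⇒m≤o (K ℕ.⊔ L) N k≥)))
      s≤1 : s ≤ 1ℚ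
      s≤1 = ≤-trans (by-slack f (<⇒≤ 0<f) refl) s+f≤1
      f≤s : f ≤ s
      f≤s = ≤-trans (p⊓q≤p e e′) (≤-trans (≤-reflexive (sym (+-identityˡ e)))
        (e≤x k (ℕ.m⊔n≤o⇒m≤o K L (ℕ.m⊔n≤o⇒m≤o (K ℕ.⊔ L) N k≥))))
      3g≤q : g + (g + g) ≤ q
      3g≤q = q-p≥0⇒p≤q (subst (0ℚ ≤_)
        (solve 3 (λ q f s → (q :+ (con ⅛ :* f :+ (con ⅛ :* f :+ con ⅛ :* f)) :- s) :+ ((s :- f) :+ (con ⅛ :* f :+ con ⅛ :* f))
           := q :- (con ⅛ :* f :+ (con ⅛ :* f :+ con ⅛ :* f))) refl q f s)
        (0≤+ (p≤q⇒0≤q-p u) (0≤+ (p≤q⇒0≤q-p f≤s) (0≤+ 0≤g 0≤g))))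

module _ {δ : ℚ} (0<δ : 0ℚ < δ) (δ<1 : δ < 1ℚ) where

  open ≤-Reasoning

  -- The tosses per coin, up to the factor `R`, against the k-th entry of log (1 / x), which is a
  -- partial sum and hence large enough only eventually.
  WithinLog : ℕ → ℕ → Set
  WithinLog m J = ∃[ N ] (∀ x k → N ℕ.≤ k → Approximates δ x →
    ι (suc J) * h m ≤ ι 40 * mercator (1ℚ - x) k)

  private
    1-x≤log : ∀ {x k} → 1 ℕ.≤ k → Approximates δ x → 1ℚ - x ≤ mercator (1ℚ - x) k
    1-x≤log 1≤k ap = mercator-≥ (p≤q⇒0≤q-p (Approximates.x≤1 ap)) 1≤k

    ½[1-δ]≤log : ∀ {x k} → 1 ℕ.≤ k → Approximates δ x → ½ * (1ℚ - δ) ≤ mercator (1ℚ - x) k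
    ½[1-δ]≤log {x} {k} 1≤k ap = begin
      ½ * (1ℚ - δ)                    ≤⟨ *-monoˡ ½ 0≤½ (Approximates.complement ap) ⟩
      ½ * ((1ℚ - x) + (1ℚ - x))       ≡⟨ solve 1 (λ y → con ½ :* (y :+ y) := y) refl (1ℚ - x) ⟩
      1ℚ - x                          ≤⟨ 1-x≤log 1≤k ap ⟩
      mercator (1ℚ - x) k             ∎

  module _ (δ≤½ : δ ≤ ½) where

    private
      -- With these few dyadic levels, the first term of the series is used alone; it contributes at
      -- least ¼.
      few : ∀ j → j ℕ.≤ 1 → WithinLog 0 (2 ℕ.+ j)
      few j j≤1 = 1 , λ x k 1≤k ap → begin
        ι (3 ℕ.+ j) * 1ℚ                ≡⟨ *-identityʳ (ι (3 ℕ.+ j)) ⟩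
        ι (3 ℕ.+ j)                     ≤⟨ ι-mono (ℕ.+-monoʳ-≤ 3 j≤1) ⟩
        ι 4                             ≤⟨ from-yes (ι 4 ≤? ι 40 * (½ * ½)) ⟩
        ι 40 * (½ * ½)                  ≤⟨ *-monoˡ (ι 40) (0≤ι 40) (*-monoˡ ½ 0≤½ (+-monoʳ-≤ 1ℚ (neg-antimono-≤ δ≤½))) ⟩
        ι 40 * (½ * (1ℚ - δ))           ≤⟨ *-monoˡ (ι 40) (0≤ι 40) (½[1-δ]≤log 1≤k ap) ⟩
        ι 40 * mercator (1ℚ - x) k      ∎

      -- Passing from δ to `x` costs one power of ½, and the series yields (i + 1) / 8. Covering J +
      -- 1 = i + 5 ≤ 5 (i + 1) takes 5 * 8 = 40, the origin of that constant.
      many : ∀ i → δ ≤ ½ ^ (2 ℕ.+ i) → WithinLog 0 (4 ℕ.+ i)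
      many i δ≤½^ = 2 ℕ.^ suc i , λ x k N≤k ap → let open Approximates ap in begin
        ι (5 ℕ.+ i) * 1ℚ                ≡⟨ *-identityʳ (ι (5 ℕ.+ i)) ⟩
        ι (5 ℕ.+ i)                     ≤⟨ ι-mono (ℕ.+-monoʳ-≤ 5 (ℕ.m≤n*m i 5)) ⟩
        ι (5 ℕ.+ 5 ℕ.* i)               ≡⟨ cong ι (ℕ.*-suc 5 i) ⟨
        ι (5 ℕ.* suc i)                 ≡⟨ ι-* 5 (suc i) ⟩
        ι 5 * ι (suc i)                 ≡⟨ cong (_* ι (suc i)) {x = ι 5} {y = ι 40 * ⅛} refl ⟩
        ι 40 * ⅛ * ι (suc i)            ≡⟨ trans (*-assoc (ι 40) ⅛ (ι (suc i))) (cong (ι 40 *_) (*-comm ⅛ (ι (suc i)))) ⟩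
        ι 40 * (ι (suc i) * ⅛)          ≤⟨ *-monoˡ (ι 40) (0≤ι 40) (mercator-≥-⅛ i
            (+-monoʳ-≤ 1ℚ (neg-antimono-≤ (≤-trans above (≤-trans (+-mono-≤ δ≤½^ δ≤½^) (≤-reflexive (half (½ ^ suc i)))))))
            (by-slack x (≤-trans (<⇒≤ 0<δ) below) (solve 1 (λ x → (con 1ℚ :- x) :+ x := con 1ℚ) refl x))
            N≤k) ⟩
        ι 40 * mercator (1ℚ - x) k      ∎

      withinLog : ∀ j → δ ≤ ½ ^ j → WithinLog 0 (2 ℕ.+ j)
      withinLog zero          _ = few 0 ℕ.z≤n
      withinLog (suc zero)    _ = few 1 ℕ.≤-refl
      withinLog (suc (suc i)) δ≤½^ = many i δ≤½^

    small-δ : ∃[ J ] (1ℚ - δ ≤ h 0 * (1ℚ - 2ℚ * ½ ^ J) × WithinLog 0 J)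
    small-δ =
      let K , hK≤δ           = archimedean δ 0<δ
          j , δ≤½ʲ , ½ʲ⁺¹≤δ = bracket (½ ^_) (from-yes (½ ^ 1 ≤? 1ℚ)) K (<⇒≤ δ<1) (≤-trans (½^≤h K) hK≤δ)
      -- The total error 2 * ½ ^ J is then ½ ^ (j + 1), which is at most δ.
      in 2 ℕ.+ j , (begin
        1ℚ - δ                               ≤⟨ +-monoʳ-≤ 1ℚ (neg-antimono-≤ ½ʲ⁺¹≤δ) ⟩
        1ℚ - ½ * ½ ^ j                       ≡⟨ solve 1 (λ x → con 1ℚ :- con ½ :* x := con 1ℚ :* (con 1ℚ :- con 2ℚ :* (con ½ :* (con ½ :* x)))) refl (½ ^ j) ⟩
        1ℚ * (1ℚ - 2ℚ * ½ ^ (2 ℕ.+ j))       ∎)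
      , withinLog j δ≤½ʲ

  large-δ : ½ ≤ δ → ∃[ m ] (1ℚ - δ ≤ h m * (1ℚ - 2ℚ * ½ ^ 2) × WithinLog m 2)
  large-δ ½≤δ =
    let K , hK≤2y          = archimedean (2ℚ * (1ℚ - δ)) 0<2y
        m , 2y≤hm , hm⁺≤2y = bracket h (h-anti {0} {1} ℕ.z≤n) K 2y≤1 hK≤2y
    in m , (begin
      1ℚ - δ                   ≡⟨ solve 1 (λ y → y := con 2ℚ :* y :* con ½) refl (1ℚ - δ) ⟩
      2ℚ * (1ℚ - δ) * ½        ≤⟨ *-monoʳ ½ 0≤½ 2y≤hm ⟩
      h m * ½                  ∎)
    , 1 , λ x k 1≤k ap → begin
      -- The choice of `m` gives h m ≤ 4 (1 - δ), so the cost vanishes as fast as the lower bound 1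
      -- - x on the logarithm.
      ι 3 * h m                      ≤⟨ *-monoˡ (ι 3) (0≤ι 3) (≤-trans (h≤2h m) (*-monoˡ 2ℚ 0≤2 hm⁺≤2y)) ⟩
      ι 3 * (2ℚ * (2ℚ * (1ℚ - δ)))   ≡⟨ solve 2 (λ t y → t :* (con 2ℚ :* (con 2ℚ :* y)) := (con 2ℚ :* con 2ℚ :* con 2ℚ :* t) :* (con ½ :* y)) refl (ι 3) (1ℚ - δ) ⟩
      ι 24 * (½ * (1ℚ - δ))          ≤⟨ *-monoˡ (ι 24) (0≤ι 24) (½[1-δ]≤log 1≤k ap) ⟩
      ι 24 * mercator (1ℚ - x) k     ≤⟨ *-monoʳ _ (≤-trans (p≤q⇒0≤q-p (Approximates.x≤1 ap)) (1-x≤log 1≤k ap)) (ι-mono (ℕ.m≤m+n 24 16)) ⟩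
      ι 40 * mercator (1ℚ - x) k     ∎
    where
    0<2y : 0ℚ < 2ℚ * (1ℚ - δ)
    0<2y = 0<* {2ℚ} (from-yes (0ℚ <? 2ℚ)) (subst (_< 1ℚ - δ) (+-inverseʳ δ) (+-monoˡ-< (- δ) δ<1))
    2y≤1 : 2ℚ * (1ℚ - δ) ≤ h 0
    2y≤1 = *-monoˡ 2ℚ 0≤2 (+-monoʳ-≤ 1ℚ (neg-antimono-≤ ½≤δ))

  -- For δ ≤ ½ there is a single window and J ≈ log₂ (1 / δ); for δ > ½ the success
  -- probability 1 - δ is already achieved with J = 2 on one of ≈ 1 / (2 (1 - δ)) windows.
  choose-parameters : ∃[ m ] ∃[ J ] (1ℚ - δ ≤ h m * (1ℚ - 2ℚ * ½ ^ J) × WithinLog m J)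
  choose-parameters with ≤-total δ ½
  ... | inj₁ δ≤½ = 0 , small-δ δ≤½
  ... | inj₂ ½≤δ = let m , success , within = large-δ ½≤δ in m , 2 , success , within

-- No biases have a gap Δ > 1, but the toss budget has to be met there as well: R = 0.
choose-rounds : ∀ {Δ} → 0ℚ < Δ → ∃[ R ] (ι R * (Δ * Δ) ≤ ι 8 × (Δ ≤ 1ℚ → (1ℚ - ½ * Δ * (½ * Δ)) ^ R ≤ ½))
choose-rounds {Δ} 0<Δ with Δ ≤? 1ℚ
... | no Δ≰1 = 0 , ≤-trans (≤-reflexive (*-zeroˡ (Δ * Δ))) (0≤ι 8) , λ Δ≤1 → ⊥-elim (Δ≰1 Δ≤1)
... | yes Δ≤1 =
  let R , Rt²≤2 , halved = halving-exponent (0<* 0<t 0<t) t²≤1 in R , (begin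
    ι R * (Δ * Δ)             ≡⟨ solve 2 (λ r d → r :* (d :* d) := con 2ℚ :* (con 2ℚ :* (r :* (con ½ :* d :* (con ½ :* d))))) refl (ι R) Δ ⟩
    2ℚ * (2ℚ * (ι R * (t * t)))   ≤⟨ *-monoˡ 2ℚ 0≤2 (*-monoˡ 2ℚ 0≤2 Rt²≤2) ⟩
    2ℚ * (2ℚ * 2ℚ)            ∎) , λ _ → halved
  where
  open ≤-Reasoning
  t : ℚ
  -- Matches are analysed for a gap of t + t; R t ^ 2 ≤ 2 becomes R Δ ^ 2 ≤ 8.
  t = ½ * Δ
  0<t : 0ℚ < t
  0<t = 0<* 0<½ 0<Δ
  t≤1 : t ≤ 1ℚ
  t≤1 = ≤-trans (*-monoˡ ½ 0≤½ Δ≤1) (from-yes (½ * 1ℚ ≤? 1ℚ))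
  t²≤1 : t * t ≤ 1ℚ
  t²≤1 = ≤-trans (*-monoˡ t (<⇒≤ 0<t) t≤1) (≤-trans (≤-reflexive (*-identityʳ t)) t≤1)

-- From rational to real biases

Eventually : (ℕ → Set) → Set
Eventually P = ∃[ N ] (∀ k → N ℕ.≤ k → P k)

both : ∀ {P Q} → Eventually P → Eventually Q → Eventually (λ k → P k × Q k)
both (M , p) (N , q) = M ℕ.⊔ N , λ k k≥ → p k (ℕ.m⊔n≤o⇒m≤o M N k≥) , q k (ℕ.m⊔n≤o⇒n≤o M N k≥)

eventually-∀ : ∀ {n} {P : Fin n → ℕ → Set} → (∀ i → Eventually (P i)) → Eventually (λ k → ∀ i → P i k)
eventually-∀ {zero}  p = 0 , λ k _ ()
eventually-∀ {suc n} p with both (p zero) (eventually-∀ (p ∘ suc))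
... | N , q = N , λ { k k≥ zero → proj₁ (q k k≥) ; k k≥ (suc i) → proj₂ (q k k≥) i }

near-unit : ∀ p {η} → 0ℚ ≤ η → 0ℚ ≤ p + η → p ≤ 1ℚ + η → ∃[ q ] (InUnit q × ∣ p - q ∣ ≤ η)
near-unit p {η} 0≤η -η≤p p≤1+η with ≤-total p 0ℚ | ≤-total 1ℚ p
... | inj₁ p≤0 | _ = 0ℚ , (≤-refl , 0≤1) , subst (_≤ η)
  (trans (sym (0≤p⇒∣p∣≡p (p≤q⇒0≤q-p p≤0))) (∣-∣-sym 0ℚ p))
  (by-slack (p + η) -η≤p (solve 2 (λ p η → (con 0ℚ :- p) :+ (p :+ η) := η) refl p η))
... | inj₂ 0≤p | inj₁ 1≤p = 1ℚ , (0≤1 , ≤-refl) , subst (_≤ η) (sym (0≤p⇒∣p∣≡p (p≤q⇒0≤q-p 1≤p)))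
  (by-slack _ (p≤q⇒0≤q-p p≤1+η) (solve 2 (λ p η → (p :- con 1ℚ) :+ ((con 1ℚ :+ η) :- p) := η) refl p η))
... | inj₂ 0≤p | inj₂ p≤1 = p , (0≤p , p≤1) , subst (_≤ η) (sym (cong ∣_∣ (+-inverseʳ p))) 0≤η

seq-log1/ : ∀ x 0<x x<1 k → seq (log1/ x 0<x x<1) k ≡ mercator (1ℚ - seq x k) k
seq-log1/ x (_ , _ , _ , _) (_ , _ , _ , _) k = refl

-- The toss budget, and success for rational biases

module _ (n m J R d : ℕ) (n<2^d : suc n ℕ.≤ 2 ℕ.^ d) where

  private
    P : Program n 0
    P = windowProgram n m J R d n<2^d

  -- 2560 = 2 * 4 * 8 * 40: two tosses per round, (2 D) ^ 2 in place of x ^ 2, the bound on R D ^ 2,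
  -- and the comparison with the logarithm.
  tosses-bound : ∀ {D x M} → 0ℚ ≤ D → ι R * (D * D) ≤ ι 8 → 0ℚ ≤ x → x ≤ D + D → ι (suc J) * h m ≤ ι 40 * M →
                 ι (programTosses P) * (x * x) ≤ ι 2560 * ι (suc n) * M
  tosses-bound {D} {x} {M} 0≤D RD²≤8 0≤x x≤2D logs = begin
    ι (programTosses P) * (x * x)
      ≤⟨ *-monoˡ (ι (programTosses P)) (0≤ι (programTosses P)) (≤-trans (*-monoˡ x 0≤x x≤2D) (*-monoʳ (D + D) (0≤+ 0≤D 0≤D) x≤2D)) ⟩
    ι (programTosses P) * ((D + D) * (D + D))
      ≤⟨ *-monoʳ _ (0≤* (0≤+ 0≤D 0≤D) (0≤+ 0≤D 0≤D)) (ι-mono (windowProgram-tosses n m J R d n<2^d)) ⟩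
    ι (2 ℕ.* (suc J ℕ.* R ℕ.* q)) * ((D + D) * (D + D))
      ≡⟨ cong (_* ((D + D) * (D + D))) (trans (ι-* 2 (suc J ℕ.* R ℕ.* q)) (cong (ι 2 *_)
           (trans (ι-* (suc J ℕ.* R) q) (cong (_* ι q) (ι-* (suc J) R))))) ⟩
    2ℚ * (ι (suc J) * ι R * ι q) * ((D + D) * (D + D))
      ≡⟨ solve 4 (λ s r q D → con 2ℚ :* (s :* r :* q) :* ((D :+ D) :* (D :+ D))
           := con 2ℚ :* con 2ℚ :* con 2ℚ :* (r :* (D :* D)) :* (s :* q)) refl (ι (suc J)) (ι R) (ι q) D ⟩
    ι 8 * (ι R * (D * D)) * (ι (suc J) * ι q)
      ≤⟨ *-monoʳ _ (0≤* (0≤ι (suc J)) (0≤ι q)) (*-monoˡ (ι 8) (0≤ι 8) RD²≤8) ⟩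
    ι 64 * (ι (suc J) * ι q)
      ≤⟨ *-monoˡ (ι 64) (0≤ι 64) (*-monoˡ (ι (suc J)) (0≤ι (suc J)) q≤n/m) ⟩
    ι 64 * (ι (suc J) * (ι (suc n) * h m))
      ≡⟨ solve 4 (λ c s n h → c :* (s :* (n :* h)) := c :* n :* (s :* h)) refl (ι 64) (ι (suc J)) (ι (suc n)) (h m) ⟩
    ι 64 * ι (suc n) * (ι (suc J) * h m)
      ≤⟨ *-monoˡ (ι 64 * ι (suc n)) (0≤* (0≤ι 64) (0≤ι (suc n))) logs ⟩
    ι 64 * ι (suc n) * (ι 40 * M)
      ≡⟨ solve 4 (λ c n e M → c :* n :* (e :* M) := c :* e :* n :* M) refl (ι 64) (ι (suc n)) (ι 40) M ⟩
    ι 64 * ι 40 * ι (suc n) * M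
      ≡⟨ cong (λ c → c * ι (suc n) * M) (sym (ι-* 64 40)) ⟩
    ι 2560 * ι (suc n) * M ∎
    where
    open ≤-Reasoning
    q : ℕ
    q = n ℕ./ suc m
    q≤n/m : ι q ≤ ι (suc n) * h m
    q≤n/m = begin
      ι q                         ≡⟨ *-identityʳ (ι q) ⟨
      ι q * 1ℚ                    ≡⟨ cong (ι q *_) (trans (sym (h*ι m)) (*-comm (h m) (ι (suc m)))) ⟩
      ι q * (ι (suc m) * h m)     ≡⟨ *-assoc (ι q) (ι (suc m)) (h m) ⟨
      ι q * ι (suc m) * h m       ≡⟨ cong (_* h m) (ι-* q (suc m)) ⟨
      ι (q ℕ.* suc m) * h m       ≤⟨ *-monoʳ (h m) (0≤h m) (ι-mono (ℕ.≤-trans (ℕ.m/n*n≤m n (suc m)) (ℕ.n≤1+n n))) ⟩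
      ι (suc n) * h m             ∎

  module _ {D : ℚ} (0<D : 0ℚ < D) (halved : D ≤ 1ℚ → (1ℚ - ½ * D * (½ * D)) ^ R ≤ ½) where

    ≤probability : ∀ {bias : Fin (suc n) → ℚ} → (∀ i → InUnit (bias i)) → ∀ {best second} → second ≢ best →
      (∀ i → i ≢ best → bias i + D ≤ bias best) → ∀ c cs p → lookup (c ∷ cs) p ≡ best →
      h m * (1ℚ - 2ℚ * ½ ^ J) ≤ probability bias best P c cs []
    ≤probability {bias} bias∈ {best} {second} second≢best gap = windowProgram-best n m J R d n<2^d bias∈
      (<⇒≤ (0<* 0<½ 0<D)) ½D≤1 (halved D≤1)
      λ i i≢ → ≤-trans (≤-reflexive (cong (_+_ (bias i)) (half D))) (gap i i≢)
      where
      D≤1 : D ≤ 1ℚ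
      -- The existence of a second coin rules out D > 1, where `choose-rounds` guarantees no
      -- halving.
      D≤1 = ≤-trans (by-slack (bias second) (proj₁ (bias∈ second)) (+-comm D (bias second)))
              (≤-trans (gap second second≢best) (proj₂ (bias∈ best)))
      ½D≤1 : ½ * D ≤ 1ℚ
      ½D≤1 = ≤-trans (*-monoˡ ½ 0≤½ D≤1) (from-yes (½ * 1ℚ ≤? 1ℚ))

-- Biases only converge to values in [0 , 1] that respect the gap, so the rational
-- approximants are first moved by at most η to rational biases that satisfy both.
module _ {n : ℕ} (P : Program n 0) {D γ v : ℚ} (0<γ : 0ℚ < γ)
         (correct : ∀ {bias : Fin (suc n) → ℚ} → (∀ i → InUnit (bias i)) → ∀ {best second} → second ≢ best →
           (∀ i → i ≢ best → bias i + D ≤ bias best) → ∀ c cs p → lookup (c ∷ cs) p ≡ best →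
           v ≤ probability bias best P c cs [])
         {Δ : ℝ} (Δ≥ : Eventually λ k → D + (γ + γ) ≤ seq Δ k)
         {bias : Fin (suc n) → ℝ} (bias∈ : ∀ i → 0ᴿ ≤ᴿ bias i × bias i ≤ᴿ 1ᴿ)
         {best : Fin (suc n)} (isBest : MostBiasedWithGap bias best Δ) where

  open MostBiasedWithGap isBest

  private
    record NearUnitWithGap (η : ℚ) (k : ℕ) : Set where
      field
        nearby : Fin (suc n) → ℚ
        ∈unit  : ∀ i → InUnit (nearby i)
        close  : ∀ i → ∣ seq (bias i) k - nearby i ∣ ≤ η
        gap    : ∀ i → i ≢ best → nearby i + D ≤ nearby best

    -- The condition on `i` sits under `Eventually`, so that `eventually-∀` can merge the thresholds
    -- of all coins.
    ≤second : ∀ η → 0ℚ < η → ∀ i → Eventually λ k → i ≢ best → seq (bias i) k ≤ seq (bias second) k + η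
    ≤second η 0<η i with i Fin.≟ best
    ... | yes i≡best = 0 , λ _ _ i≢best → ⊥-elim (i≢best i≡best)
    ... | no  i≢best = let N , b≤ = second-max i i≢best η 0<η in N , λ k N≤k _ → b≤ k N≤k

    -- Four errors of η, from moving both biases and from the two eventual inequalities, are covered
    -- by the reserve of two γ.
    shifted : ∀ {η} b q s t Δ q′ → η + η ≤ γ → ∣ b - q ∣ ≤ η → b ≤ s + η → Δ ≤ (t + - s) + η → D + (γ + γ) ≤ Δ →
              ∣ t - q′ ∣ ≤ η → q + D ≤ q′
    shifted {η} b q s t Δ q′ 2η≤γ b≈q b≤ Δ≤ ≤Δ t≈q′ = q-p≥0⇒p≤q (subst (0ℚ ≤_)
      (solve 9 (λ b q s t Δ q′ D γ η →
         (η :- (q :- b)) :+ (((s :+ η) :- b) :+ ((((t :+ (:- s)) :+ η) :- Δ) :+ ((Δ :- (D :+ (γ :+ γ)))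
           :+ ((η :- (t :- q′)) :+ ((γ :- (η :+ η)) :+ (γ :- (η :+ η)))))))
         := q′ :- (q :+ D)) refl b q s t Δ q′ D γ η)
      (0≤+ (p≤q⇒0≤q-p (≤-trans (p≤∣p∣ (q - b)) (subst (_≤ η) (∣-∣-sym b q) b≈q)))
        (0≤+ (p≤q⇒0≤q-p b≤) (0≤+ (p≤q⇒0≤q-p Δ≤) (0≤+ (p≤q⇒0≤q-p ≤Δ)
          (0≤+ (p≤q⇒0≤q-p (≤-trans (p≤∣p∣ (t - q′)) t≈q′))
            (0≤+ (p≤q⇒0≤q-p 2η≤γ) (p≤q⇒0≤q-p 2η≤γ))))))))

    nearUnitWithGap : ∀ η → 0ℚ < η → η + η ≤ γ → Eventually (NearUnitWithGap η)
    nearUnitWithGap η 0<η 2η≤γ =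
      let N , all = both (both Δ≥ (proj₂ gap η 0<η)) (eventually-∀ λ i →
                      both (both (proj₁ (bias∈ i) η 0<η) (proj₂ (bias∈ i) η 0<η)) (≤second η 0<η i))
      in N , λ k N≤k →
        let (D+2γ≤Δ , Δ≤) , coin = all k N≤k
            near : ∀ i → ∃[ q ] (InUnit q × ∣ seq (bias i) k - q ∣ ≤ η)
            near i = near-unit (seq (bias i) k) (<⇒≤ 0<η) (proj₁ (proj₁ (coin i))) (proj₂ (proj₁ (coin i)))
        in record
          { nearby = λ i → proj₁ (near i)
          ; ∈unit  = λ i → proj₁ (proj₂ (near i))
          ; close  = λ i → proj₂ (proj₂ (near i))
          ; gap    = λ i i≢best → shifted (seq (bias i) k) (proj₁ (near i)) (seq (bias second) k)
              (seq (bias best) k) (seq Δ k) (proj₁ (near best)) 2η≤γ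
              (proj₂ (proj₂ (near i))) (proj₂ (coin i) i≢best) Δ≤ D+2γ≤Δ (proj₂ (proj₂ (near best)))
          }

    L : ℚ
    L = lipschitzConstant P

    ≤perturbed : ∀ {ε} x y → v ≤ y → ∣ x - y ∣ ≤ ε → v ≤ x + ε
    ≤perturbed {ε} x y v≤y x≈y = ≤-trans v≤y (by-slack (ε - (y - x))
      (p≤q⇒0≤q-p (≤-trans (p≤∣p∣ (y - x)) (subst (_≤ ε) (∣-∣-sym x y) x≈y)))
      (solve 3 (λ x y ε → y :+ (ε :- (y :- x)) := x :+ ε) refl x y ε))

    ≤realProbability : ∀ {η ε k} → 0ℚ < η → η ≤ 1ℚ → L * η ≤ ε → NearUnitWithGap η k →
      ∀ c cs p → lookup (c ∷ cs) p ≡ best → v ≤ seq (programProbability bias best P c cs []) k + ε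
    ≤realProbability {η} {ε} {k} 0<η η≤1 Lη≤ε near c cs p p≡best =
      subst (λ x → v ≤ x + ε) (sym (seq-programProbability bias best k P c cs []))
        (≤perturbed (probability (λ i → seq (bias i) k) best P c cs []) (probability nearby best P c cs [])
          (correct ∈unit second≢best Near.gap c cs p p≡best)
          (≤-trans (probability-lipschitz ∈unit (<⇒≤ 0<η) η≤1 close P c cs []) Lη≤ε))
      where
      module Near = NearUnitWithGap near
      open Near using (nearby; ∈unit; close)

  ≤outputProbability : ∀ order ε → 0ℚ < ε → Eventually λ k →
    v ≤ seq (outputProbability (start P) bias order best) k + ε
  ≤outputProbability order ε 0<ε =
    let η₁ , 0<η₁ , Lη₁≤ε = scale-down L ε (0≤lipschitzConstant P) 0<ε
        -- `η₁` keeps the change of the probability below ε, `½ * γ` preserves the gap, and `1ℚ` is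
        -- the range of the Lipschitz estimate.
        η                   = η₁ ⊓ (½ * γ ⊓ 1ℚ)
        0<η                 = 0<⊓ 0<η₁ (0<⊓ (0<* 0<½ 0<γ) 0<1)
        η≤½γ                = ≤-trans (p⊓q≤q η₁ (½ * γ ⊓ 1ℚ)) (p⊓q≤p (½ * γ) 1ℚ)
        η≤1                 = ≤-trans (p⊓q≤q η₁ (½ * γ ⊓ 1ℚ)) (p⊓q≤q (½ * γ) 1ℚ)
        N , near            = nearUnitWithGap η 0<η (≤-trans (+-mono-≤ η≤½γ η≤½γ) (≤-reflexive (half γ)))
    in N , λ k N≤k → ≤realProbability 0<η η≤1
         (≤-trans (*-monoˡ L (0≤lipschitzConstant P) (p⊓q≤p η₁ (½ * γ ⊓ 1ℚ))) Lη₁≤ε) (near k N≤k)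
         (order ⟨$⟩ʳ zero) (tabulate (λ i → order ⟨$⟩ʳ suc i)) (order ⟨$⟩ˡ best)
         (trans (lookup∘tabulate (order ⟨$⟩ʳ_) (order ⟨$⟩ˡ best)) (inverseʳ order))

-- At least two coins make the logarithm at least 1, so it can absorb the two additional places.
memory-bound : ∀ n → 2 ℕ.≤ n → suc (suc ⌊log₂ n ⌋) ℕ.≤ 2560 ℕ.* ⌊log₂ n ⌋
memory-bound n 2≤n = ℕ.≤-trans
  (ℕ.+-monoˡ-≤ l (ℕ.*-monoʳ-≤ 2 (subst (ℕ._≤ l) (⌊log₂[2^n]⌋≡n 1) (⌊log₂⌋-mono-≤ 2≤n))))
  (ℕ.≤-trans (ℕ.≤-reflexive (ℕ.+-comm (2 ℕ.* l) l)) (ℕ.*-monoˡ-≤ l (ℕ.m≤m+n 3 2557)))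
  where
  l : ℕ
  l = ⌊log₂ n ⌋

propositionA1 :
    Σ[ C ∈ ℕ ] (∀ (n : ℕ) → 2 ℕ.≤ n → (Δ δ : ℝ) → 0ᴿ <ᴿ Δ → (0<δ : 0ᴿ <ᴿ δ) → (δ<1 : δ <ᴿ 1ᴿ) →
      Σ[ A ∈ Algorithm n ]
        ( fromℕ (tosses A) *ᴿ (Δ *ᴿ Δ) ≤ᴿ fromℕ C *ᴿ fromℕ n *ᴿ log1/ δ 0<δ δ<1
        × memory A ℕ.≤ C ℕ.* ⌊log₂ n ⌋
        × (∀ (bias : Fin n → ℝ) → (∀ i → 0ᴿ ≤ᴿ bias i × bias i ≤ᴿ 1ᴿ) →
           ∀ (best : Fin n) → MostBiasedWithGap bias best Δ →
           ∀ (order : Permutation′ n) →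
           1ᴿ -ᴿ δ ≤ᴿ outputProbability A bias order best)))
propositionA1 = 2560 , λ where
  (suc n) 2≤n Δ δ 0<Δ 0<δ δ<1 →
    let D , γ , 0<D , 0<γ , Δ≈D       = positive-approximation Δ 0<Δ
        D′ , 0<D′ , D′<1 , δ≈D′       = unit-approximation δ 0<δ δ<1
        m , J , success , within-log  = choose-parameters 0<D′ D′<1
        R , RD²≤8 , halved            = choose-rounds 0<D
        d                             = suc ⌊log₂ suc n ⌋
        n<2^d                         = n≤2^[1+⌊log₂n⌋] (suc n)
        L , within-log′               = within-log
    in start (windowProgram n m J R d n<2^d)
     , (λ ε 0<ε →
         let N , near = both Δ≈D (both δ≈D′ (L , λ k L≤k → within-log′ (seq δ k) k L≤k))
         in N , λ k N≤k →
           let (≤Δ , Δ≤) , δ≈ , log≥ = near k N≤k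
           in ≤-trans (tosses-bound n m J R d n<2^d (<⇒≤ 0<D) RD²≤8
                        (≤-trans (0≤+ (<⇒≤ 0<D) (0≤+ (<⇒≤ 0<γ) (<⇒≤ 0<γ))) ≤Δ) Δ≤ (log≥ δ≈))
                (≤-trans (≤-reflexive (cong (ι 2560 * ι (suc n) *_) (sym (seq-log1/ δ 0<δ δ<1 k))))
                  (by-slack ε (<⇒≤ 0<ε) refl)))
     , ℕ.≤-trans (windowProgram-memory n m J R d n<2^d) (memory-bound (suc n) 2≤n)
     , λ bias bias∈ best isBest order ε 0<ε →
         let N , near = both δ≈D′ (≤outputProbability (windowProgram n m J R d n<2^d) 0<γ
                                     (≤probability n m J R d n<2^d 0<D halved) {Δ}
                                     (proj₁ Δ≈D , λ k N≤k → proj₁ (proj₂ Δ≈D k N≤k)) bias∈ isBest order ε 0<ε)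
         in N , λ k N≤k → let δ≈ , ≤out = near k N≤k in
           -- `D′` approximates δ from below, so success with probability 1 - D′ is more than
           -- enough.
           ≤-trans (+-monoʳ-≤ 1ℚ (neg-antimono-≤ (Approximates.below δ≈))) (≤-trans success ≤out)
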